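{- Let $\mathcal{G}$ be any family of graphs with $\mathcal{T} \subseteq \mathcal{G} \subseteq \mathcal{C}$. Then: (1) $k=1,2,4$ are forcing for $\mathcal{G}$. (2) $k=3,5,6,8$ are weakly forcing for $\mathcal{G}$, with $f_{\mathcal{G}}(3)=0$, $f_{\mathcal{G}}(5)=-1$, $f_{\mathcal{G}}(6)=0$, $f_{\mathcal{G}}(8)=-1$. (3) $k=7$ and every $k \ge 9$ collapse for $\mathcal{G}$. Furthermore, for every such $k$ and integer $m$: (a) if $k=4m+3$, then $c_{\mathcal{G}}(k) = -\frac{m}{3m+2}$; (b) if $k=4m+2$, then $c_{\mathcal{G}}(k) = -\frac{m-1}{3m+1}$; (c) if $k=4m+1$, then $-\frac{m-1}{3m+1} \ge c_{\mathcal{G}}(k) \ge -\frac{2m-1}{6m+1}$; (d) if $k=4m$, then $-\frac{m-2}{3m} \ge c_{\mathcal{G}}(k) \ge -\frac{2m-3}{6m-1}$.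
   Context: All graphs are finite and simple. For a graph $G$, a weighing is a function $w: E(G) \to \{ -1,1\}$, and for a subgraph $H$ of $G$, $w(H)=\sum_{e\in E(H)} w(e)$. For a positive integer $k$, $w$ is $k$-local positive if $w(H)>0$ for every connected subgraph $H$ of $G$ with exactly $k$ edges. Let $\mathcal{G}$ be an infinite family of connected graphs. $k$ is forcing for $\mathcal{G}$ if for all but finitely many $G \in \mathcal{G}$, every $k$-local positive weighing $w$ of $G$ satisfies $w(G)>0$. If $k$ is not forcing for $\mathcal{G}$, $k$ is weakly forcing for $\mathcal{G}$ if there is a constant $C$ (possibly negative) such that for all but finitely many $G\in\mathcal{G}$, every $k$-local positive weighing $w$ of $G$ has $w(G)\ge C$; then $f_{\mathcal{G}}(k)$ denotes the maximum such $C$. If $k$ is neither forcing nor weakly forcing, $k$ collapses for $\mathcal{G}$, and $c_{\mathcal{G}}(k)$ denotes the supremum of all $c \le 0$ such that $w(G) \ge c|E(G)| - o(|E(G)|)$ for all $G \in \mathcal{G}$ and all $k$-local positive weighings $w$ of $G$. $\mathcal{C}$ denotes the family of all connected graphs and $\mathcal{T}$ the family of all trees. -}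

module Defs where

open import Data.Nat as ℕ using (ℕ; zero; suc)
open import Data.Fin as Fin using (Fin; zero; suc; inject₁; fromℕ)
open import Data.Fin.Properties using (_<?_)
open import Data.Bool using (Bool; true; false; if_then_else_; _∧_)
open import Data.List using (List; []; _∷_; map; concatMap; foldr; allFin)
open import Data.Integer as ℤ using (ℤ; +_; _◃_)
open import Data.Rational as ℚ using (ℚ; _/_; 0ℚ)
open import Data.Sign using (Sign)
open import Data.Product using (Σ; ∃; _×_; _,_)
open import Data.Sum using (_⊎_)
open import Data.Empty using (⊥)
open import Relation.Nullary using (¬_)
open import Relation.Nullary.Decidable using (⌊_⌋)
open import Relation.Binary.PropositionalEquality using (_≡_)
open import Function.Definitions using (Injective)


record Graph : Set where
  field
    n      : ℕ
    adj    : Fin n → Fin n → Bool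
    sym    : ∀ i j → adj i j ≡ adj j i
    irrefl : ∀ i → adj i i ≡ false
open Graph public

Adj : {n : ℕ} → (Fin n → Fin n → Bool) → Fin n → Fin n → Set
Adj E u v = (u Fin.< v × E u v ≡ true) ⊎ (v Fin.< u × E v u ≡ true)

data Walk {n : ℕ} (E : Fin n → Fin n → Bool) : Fin n → Fin n → Set where
  here : ∀ {u} → Walk E u u
  step : ∀ {u x v} → Adj E u x → Walk E x v → Walk E u v

IsConnected : Graph → Set
IsConnected G = Fin (n G) × (∀ u v → Walk (adj G) u v)

HasCycle : Graph → Set
HasCycle G = Σ ℕ λ l → Σ (Fin (suc (suc (suc l))) → Fin (n G)) λ f →
  Injective _≡_ _≡_ f ×
  (∀ (i : Fin (suc (suc l))) → adj G (f (inject₁ i)) (f (suc i)) ≡ true) ×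
  (adj G (f (fromℕ (suc (suc l)))) (f zero) ≡ true)

IsTree : Graph → Set
IsTree G = IsConnected G × ¬ HasCycle G

sumℤ : List ℤ → ℤ
sumℤ = foldr ℤ._+_ (+ 0)

pairSum : {n : ℕ} → (Fin n → Fin n → ℤ) → ℤ
pairSum {n} f = sumℤ (concatMap (λ i → map (λ j → if ⌊ i <? j ⌋ then f i j else + 0)
                                             (allFin n)) (allFin n))

edgeCount : {n : ℕ} → (Fin n → Fin n → Bool) → ℤ
edgeCount E = pairSum (λ i j → if E i j then + 1 else + 0)

-- a weighing: the sign of the edge {i , j} (i < j) is w i j; entries at
-- non-edges or with i ≥ j are irrelevant
Weighing : Graph → Set
Weighing G = Fin (n G) → Fin (n G) → Sign

weightOn : (G : Graph) → Weighing G → (Fin (n G) → Fin (n G) → Bool) → ℤ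
weightOn G w E = pairSum (λ i j → if E i j then w i j ◃ 1 else + 0)

wG : (G : Graph) → Weighing G → ℤ
wG G w = weightOn G w (adj G)

numEdges : Graph → ℤ
numEdges G = edgeCount (adj G)

record Subgraph (G : Graph) : Set where
  field
    vs  : Fin (n G) → Bool
    es  : Fin (n G) → Fin (n G) → Bool
    sub : ∀ i j → i Fin.< j → es i j ≡ true →
          adj G i j ≡ true × vs i ≡ true × vs j ≡ true
open Subgraph public

IsConnectedSub : {G : Graph} → Subgraph G → Set
IsConnectedSub H = (∃ λ v → vs H v ≡ true) ×
  (∀ u v → vs H u ≡ true → vs H v ≡ true → Walk (es H) u v)

LocalPositive : (G : Graph) → ℕ → Weighing G → Set
LocalPositive G k w = (H : Subgraph G) → IsConnectedSub H →
  edgeCount (es H) ≡ + k → + 0 ℤ.< weightOn G w (es H)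

-- Families of graphs are predicates on graphs.  Since there are only
-- finitely many graphs on Fin n for each n, "for all but finitely many
-- G ∈ 𝒢" is "for all G ∈ 𝒢 with at least N vertices", for some N.

Family : Set₁
Family = Graph → Set

Eventually : Family → (Graph → Set) → Set
Eventually 𝒢 P = ∃ λ N → ∀ G → 𝒢 G → N ℕ.≤ n G → P G

Forcing : Family → ℕ → Set
Forcing 𝒢 k = Eventually 𝒢 λ G → ∀ w → LocalPositive G k w → + 0 ℤ.< wG G w

Bound : Family → ℕ → ℤ → Set
Bound 𝒢 k C = Eventually 𝒢 λ G → ∀ w → LocalPositive G k w → C ℤ.≤ wG G w

WeaklyForcing : Family → ℕ → Set
WeaklyForcing 𝒢 k = ¬ Forcing 𝒢 k × ∃ λ C → Bound 𝒢 k C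

-- k is weakly forcing and f_𝒢(k) = C (maximum admissible constant;
-- since w(G) ∈ ℤ, real constants reduce to integer ones)
fEquals : Family → ℕ → ℤ → Set
fEquals 𝒢 k C = WeaklyForcing 𝒢 k × Bound 𝒢 k C ×
  (∀ C' → C ℤ.< C' → ¬ Bound 𝒢 k C')

Collapses : Family → ℕ → Set
Collapses 𝒢 k = ¬ Forcing 𝒢 k × ¬ WeaklyForcing 𝒢 k

ℤtoℚ : ℤ → ℚ
ℤtoℚ z = z / 1

ℕtoℚ : ℕ → ℚ
ℕtoℚ m = + m / 1

LittleO : (ℕ → ℚ) → Set
LittleO g = ∀ (ε : ℚ) → 0ℚ ℚ.< ε → ∃ λ N → ∀ m → N ℕ.≤ m →
  ℚ.∣ g m ∣ ℚ.≤ ε ℚ.* ℕtoℚ m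

Admissible : Family → ℕ → ℚ → Set
Admissible 𝒢 k c = c ℚ.≤ 0ℚ × Σ (ℕ → ℚ) λ g → LittleO g ×
  (∀ G → 𝒢 G → ∀ w → LocalPositive G k w →
     c ℚ.* ℤtoℚ (numEdges G) ℚ.- g (ℤ.∣ numEdges G ∣) ℚ.≤ ℤtoℚ (wG G w))

-- c_𝒢(k) ≥ L  (the supremum is at least L)
cAtLeast : Family → ℕ → ℚ → Set
cAtLeast 𝒢 k L = ∀ c → c ℚ.< L → ∃ λ c' → c ℚ.≤ c' × Admissible 𝒢 k c'

-- c_𝒢(k) ≤ U  (the supremum is at most U)
cAtMost : Family → ℕ → ℚ → Set
cAtMost 𝒢 k U = ∀ c → Admissible 𝒢 k c → c ℚ.≤ U

cEquals : Family → ℕ → ℚ → Set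
cEquals 𝒢 k q = cAtLeast 𝒢 k q × cAtMost 𝒢 k q

-- the fraction p / d (d is nonzero at every use)
frac : ℤ → ℕ → ℚ
frac p zero = 0ℚ
frac p (suc d) = p / suc d

{-# OPTIONS --safe #-}
-- Let a = ⌊(k - 1) / 2⌋ and q = k - a, and let N and P count the negative and positive edges. In a k-local positive
-- weighing of a large connected graph, a connected subgraph with fewer than q positive edges has at most a negative
-- ones: otherwise it could be trimmed to exactly a + 1 negative edges and then extended to k edges.
--
-- Lower bounds. Contract the components of the negative edges and weight each of the s ≤ P + 1 resulting vertices by
-- the number of edges contracted into it. Every walk through at most q vertices then covers weight at most a. A walk
-- with 2s - 1 vertices visits everything; cutting it into pieces of q vertices gives q N ≤ a (2 P + 1 + q), which
-- yields k = 1, 2, 4 and the lower bounds on c(k). For k = 3, 5, 6, 8 each vertex of weight ≥ 2 pays for its excess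
-- with vertices of weight 0 so near that no other vertex of weight ≥ 2 can claim them; hence N ≤ s, and for k = 3, 6
-- some vertex is left over, so N < s.
--
-- Upper bounds. Take a spider whose legs consist of p positive edges followed by a negative ones, where k ≤ a + 2 p. A
-- connected subgraph with negative edges in two legs contains the positive parts of both, so among its k edges at most
-- a are negative. One leg may even be shortened by δ positive edges as long as k ≤ a + 2 p - δ.
module Submission where

open import Defs
open import Data.Nat using (ℕ; zero; suc; pred; _+_; _*_; _≤_; _<_; _∸_; z≤n; s≤s; s≤s⁻¹)
open import Data.Nat.Properties hiding (_<?_; _≟_)
import Data.Nat.Properties as ℕₚ
open import Data.Nat.Tactic.RingSolver using (solve-∀)
open import Data.Nat.DivMod using (_/_; _%_; [m+kn]%n≡m%n; m<n⇒m%n≡m; m≡m%n+[m/n]*n; m%n<n)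
open import Data.Nat.ListAction using (sum)
open import Data.Integer as ℤ using (ℤ; +_; -[1+_])
import Data.Integer.Properties as ℤₚ
import Data.Integer.Tactic.RingSolver as ℤS
open import Data.Rational as ℚ using (0ℚ)
import Data.Rational.Properties as ℚₚ
import Data.Rational.Unnormalised as ℚᵘ
import Data.Rational.Unnormalised.Properties as ℚᵘₚ
open import Data.Rational.Solver using (module +-*-Solver)
open import Data.Fin as Fin using (Fin; toℕ)
import Data.Fin.Properties as Finₚ
import Data.Fin.Relation.Unary.Top as Top
open import Data.Bool as Bool using (Bool; true; false; if_then_else_)
import Data.Bool.Properties as Boolₚ
open import Data.List using (List; []; _∷_; _++_; length; map; concatMap; filter; allFin; take; drop; cartesianProduct; upTo)
open import Data.List.Properties using (length-++; length-map; filter-accept; filter-reject; length-tabulate; length-take; length-drop; take++drop≡id; map-∘; map-++; map-cong; length-upTo)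
open import Data.List.Membership.Propositional using (_∈_; _∉_; find)
open import Data.List.Membership.Propositional.Properties using (∈-filter⁺; ∈-filter⁻; ∈-map⁺; ∈-map⁻; ∈-++⁺ˡ; ∈-++⁺ʳ; ∈-++⁻; ∈-allFin; ∈-concatMap⁺; ∈-concatMap⁻; ∈-cartesianProduct⁺; ∈-upTo⁺; ∈-upTo⁻)
import Data.List.Membership.DecPropositional as DecMembership
open import Data.List.Relation.Binary.Subset.Propositional using (_⊆_)
open import Data.List.Relation.Unary.All as All using (All; []; _∷_)
import Data.List.Relation.Unary.All.Properties as Allₚ
open import Data.List.Relation.Unary.Any as Any using (Any; here; there)
open import Data.List.Relation.Unary.AllPairs using ([]; _∷_)
open import Data.List.Relation.Unary.Linked using (Linked; []; [-]; _∷_)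
open import Data.List.Relation.Unary.Unique.Propositional using (Unique)
import Data.List.Relation.Unary.Unique.Propositional.Properties as Uniqueₚ
open import Data.Product using (Σ; ∃; ∃₂; _×_; _,_; proj₁; proj₂; uncurry; map₂)
open import Data.Product.Properties using () renaming (≡-dec to ×-≡-dec)
open import Data.Sum using (_⊎_; inj₁; inj₂; [_,_]′)
import Data.Sum as Sum
open import Data.Empty using (⊥; ⊥-elim)
open import Data.Sign as Sign using (Sign)
import Data.Sign.Properties as Signₚ
open import Function using (_∘_; id; case_of_)
import Level
open import Relation.Nullary using (¬_; Dec; yes; no; contradiction; ¬?)
open import Relation.Nullary.Decidable using (⌊_⌋; _×-dec_)
open import Relation.Binary.PropositionalEquality using (_≡_; _≢_; refl; cong; cong₂; subst; trans; module ≡-Reasoning) renaming (sym to ≡-sym)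
open import Relation.Binary.Definitions using (DecidableEquality; tri<; tri≈; tri>)
open import Relation.Unary using (Pred; Decidable)

-- The number a is the largest number of negative edges that k edges of positive total weight can
-- contain, since 2 (a + 1) ≥ k. The number q = k - a leaves room for a + 1 negative edges together
-- with the q - 1 positive edges that join q consecutive vertices of a walk. Trimming and extending
-- must keep a subgraph connected. Hence connected edge sets are kept as lists whose every tail is
-- connected: dropping heads trims, adding heads extends. The tour gives N / P ≤ 2 a / q
-- asymptotically, while a spider reaches a / p and needs 2 p ≥ q. The two agree exactly when q is
-- even, that is for k = 4m + 2 and k = 4m + 3. For odd q the spider rounds p up to (q + 1) / 2,
-- which is the gap left for k = 4m and k = 4m + 1. The same rounding leaves one positive edge of
-- slack. It allows one leg to be shortened by δ = 1, the source of f(5) = f(8) = -1. Two shortened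
-- legs would have only q - 1 positive edges together, leaving room for a + 1 negative ones.

-- Lists without repetition

module _ {A : Set} where

  length-─ : ∀ {x : A} {xs} (i : x ∈ xs) → length xs ≡ suc (length (xs Any.─ i))
  length-─ (here _)  = refl
  length-─ (there i) = cong suc (length-─ i)

  ∈-─ : ∀ {x y : A} {xs} (i : x ∈ xs) → y ∈ xs → y ≢ x → y ∈ (xs Any.─ i)
  ∈-─ (here refl) (here refl) y≢x = contradiction refl y≢x
  ∈-─ (here _)    (there j)   y≢x = j
  ∈-─ (there i)   (here refl) y≢x = here refl
  ∈-─ (there i)   (there j)   y≢x = there (∈-─ i j y≢x)

  -- Pigeonhole: each element of `xs` is deleted from `ys` in turn. Edges and vertices are counted
  -- through this inequality almost everywhere below.
  unique-⊆-length : ∀ {xs ys : List A} → Unique xs → xs ⊆ ys → length xs ≤ length ys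
  unique-⊆-length []                  xs⊆ys = z≤n
  unique-⊆-length {xs = x ∷ xs} {ys} (x∉ ∷ xs!) xs⊆ys =
    subst (suc (length xs) ≤_) (≡-sym (length-─ x∈ys)) (s≤s (unique-⊆-length xs! xs⊆))
    where
    x∈ys = xs⊆ys (here refl)
    xs⊆ : xs ⊆ (ys Any.─ x∈ys)
    xs⊆ y∈xs = ∈-─ x∈ys (xs⊆ys (there y∈xs)) (λ { refl → All.lookup x∉ y∈xs refl })

  unique-≡-length : ∀ {xs ys : List A} → Unique xs → Unique ys → xs ⊆ ys → ys ⊆ xs →
    length xs ≡ length ys
  unique-≡-length xs! ys! xs⊆ys ys⊆xs =
    ≤-antisym (unique-⊆-length xs! xs⊆ys) (unique-⊆-length ys! ys⊆xs)

  unique-∷ : ∀ {x : A} {xs} → x ∉ xs → Unique xs → Unique (x ∷ xs)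
  unique-∷ x∉xs xs! = All.tabulate (λ y∈xs → λ { refl → x∉xs y∈xs }) ∷ xs!

unique-length-Fin : ∀ {s} {xs : List (Fin s)} → Unique xs → length xs ≤ s
unique-length-Fin {s} {xs} xs! =
  subst (length xs ≤_) (length-tabulate {n = s} id) (unique-⊆-length xs! (λ {x} _ → ∈-allFin x))

module _ {A B : Set} where

  ∈-concatMap⁻′ : ∀ (f : A → List B) {xs z} → z ∈ concatMap f xs → ∃ λ x → x ∈ xs × z ∈ f x
  ∈-concatMap⁻′ f = find ∘ ∈-concatMap⁻ f

  concatMap-unique : ∀ {f : A → List B} {xs} → Unique xs → (∀ x → Unique (f x)) →
    (∀ {x y z} → z ∈ f x → z ∈ f y → x ≡ y) → Unique (concatMap f xs)
  concatMap-unique [] f! disj = []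
  concatMap-unique {f} (x∉ ∷ xs!) f! disj =
    Uniqueₚ.++⁺ (f! _) (concatMap-unique xs! f! disj) λ (z∈fx , z∈rest) →
      case ∈-concatMap⁻′ f z∈rest of λ (y , y∈xs , z∈fy) →
        All.lookup x∉ y∈xs (disj z∈fx z∈fy)

  length-concatMap : ∀ (f : A → List B) xs → length (concatMap f xs) ≡ sum (map (length ∘ f) xs)
  length-concatMap f []       = refl
  length-concatMap f (x ∷ xs) =
    trans (length-++ (f x)) (cong (_+_ (length (f x))) (length-concatMap f xs))

  ∈-concatMap : ∀ {f : A → List B} {xs x y} → x ∈ xs → y ∈ f x → y ∈ concatMap f xs
  ∈-concatMap {f} x∈xs y∈fx = ∈-concatMap⁺ f (Any.map (λ { refl → y∈fx }) x∈xs)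

module _ {A : Set} {P : Pred A Level.zero} (P? : Decidable P) where

  count : List A → ℕ
  count = length ∘ filter P?

  count-+-¬ : ∀ xs → length xs ≡ count xs + length (filter (¬? ∘ P?) xs)
  count-+-¬ []       = refl
  count-+-¬ (x ∷ xs) with P? x
  ... | yes _ = cong suc (count-+-¬ xs)
  ... | no _  = trans (cong suc (count-+-¬ xs)) (≡-sym (+-suc (count xs) _))

  sum-filter-split : ∀ (f : A → ℕ) xs →
    sum (map f xs) ≡ sum (map f (filter P? xs)) + sum (map f (filter (¬? ∘ P?) xs))
  sum-filter-split f []       = refl
  sum-filter-split f (x ∷ xs) with P? x
  ... | yes _ = trans (cong (_+_ (f x)) (sum-filter-split f xs)) (≡-sym (+-assoc (f x) _ _))
  ... | no _  = trans (cong (_+_ (f x)) (sum-filter-split f xs)) (comm-mid (f x) (sum (map f (filter P? xs))) _)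
    where
    comm-mid : ∀ a b c → a + (b + c) ≡ b + (a + c)
    comm-mid = solve-∀

sum-bound : ∀ {A : Set} (f : A → ℕ) {b} → (∀ x → f x ≤ b) → ∀ xs → sum (map f xs) ≤ length xs * b
sum-bound f f≤ []       = z≤n
sum-bound f f≤ (x ∷ xs) = +-mono-≤ (f≤ x) (sum-bound f f≤ xs)

-- Edges and reachability

Edge : ℕ → Set
Edge n = Fin n × Fin n

_≟ᵉ_ : ∀ {n} → DecidableEquality (Edge n)
_≟ᵉ_ = ×-≡-dec Finₚ._≟_ Finₚ._≟_

_∈ᵉ?_ : ∀ {n} (e : Edge n) es → Dec (e ∈ es)
_∈ᵉ?_ = DecMembership._∈?_ _≟ᵉ_

_∈ᶠ?_ : ∀ {n} (v : Fin n) vs → Dec (v ∈ vs)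
_∈ᶠ?_ = DecMembership._∈?_ Finₚ._≟_

data Reach {A : Set} (F : List (A × A)) : A → A → Set where
  stay : ∀ {u} → Reach F u u
  move : ∀ {u x v} → (u , x) ∈ F ⊎ (x , u) ∈ F → Reach F x v → Reach F u v

module _ {A : Set} where

  reach-++ : ∀ {F} {u v w : A} → Reach F u v → Reach F v w → Reach F u w
  reach-++ stay       q = q
  reach-++ (move e p) q = move e (reach-++ p q)

  reach-sym : ∀ {F} {u v : A} → Reach F u v → Reach F v u
  reach-sym stay       = stay
  reach-sym (move e p) = reach-++ (reach-sym p) (move (Sum.swap e) stay)

  reach-⊆ : ∀ {F F′} {u v : A} → F ⊆ F′ → Reach F u v → Reach F′ u v
  reach-⊆ F⊆ stay       = stay
  reach-⊆ F⊆ (move e p) = move (Sum.map F⊆ F⊆ e) (reach-⊆ F⊆ p)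

  -- The first step after which `P` fails. This is how connectivity is used: it supplies an edge
  -- leaving a given vertex set.
  reach-exit : ∀ {F} {P : Pred A Level.zero} → Decidable P → ∀ {u v} → Reach F u v → P u → ¬ P v →
    ∃₂ λ x y → ((x , y) ∈ F ⊎ (y , x) ∈ F) × P x × ¬ P y
  reach-exit P? stay Pu ¬Pv = contradiction Pu ¬Pv
  reach-exit P? {u} (move {x = x} e p) Pu ¬Pv with P? x
  ... | yes Px = reach-exit P? p Px ¬Pv
  ... | no ¬Px = u , x , e , Pu , ¬Px

-- An edge may become a walk of any length, because contraction sends a negative edge to the empty
-- walk.
reach-bind : ∀ {A B : Set} {F} {F′ : List (B × B)} (f : A → B) →
  (∀ {u v} → (u , v) ∈ F → Reach F′ (f u) (f v)) → ∀ {u v} → Reach F u v → Reach F′ (f u) (f v)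
reach-bind f g stay              = stay
reach-bind f g (move (inj₁ e) p) = reach-++ (g e) (reach-bind f g p)
reach-bind f g (move (inj₂ e) p) = reach-++ (reach-sym (g e)) (reach-bind f g p)

-- Edge lists of graphs; edge counts and weights as list lengths

pairs : ∀ n → List (Edge n)
pairs n = filter (λ e → proj₁ e Finₚ.<? proj₂ e) (cartesianProduct (allFin n) (allFin n))

pairs-unique : ∀ n → Unique (pairs n)
pairs-unique n = Uniqueₚ.filter⁺ _ (Uniqueₚ.cartesianProduct⁺ (Uniqueₚ.allFin⁺ n) (Uniqueₚ.allFin⁺ n))

∈-pairs⁺ : ∀ {n} {i j : Fin n} → i Fin.< j → (i , j) ∈ pairs n
∈-pairs⁺ {i = i} {j} i<j = ∈-filter⁺ _ (∈-cartesianProduct⁺ (∈-allFin i) (∈-allFin j)) i<j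

∈-pairs⁻ : ∀ {n} {i j : Fin n} → (i , j) ∈ pairs n → i Fin.< j
∈-pairs⁻ {n} = proj₂ ∘ ∈-filter⁻ _ {xs = cartesianProduct (allFin n) (allFin n)}

sumℤ-filter : ∀ {A : Set} {P : Pred A Level.zero} (P? : Decidable P) (g : A → ℤ) xs →
  sumℤ (map (λ x → if ⌊ P? x ⌋ then g x else + 0) xs) ≡ sumℤ (map g (filter P? xs))
sumℤ-filter P? g []       = refl
sumℤ-filter P? g (x ∷ xs) with P? x
... | yes _ = cong (ℤ._+_ (g x)) (sumℤ-filter P? g xs)
... | no _  = trans (ℤₚ.+-identityˡ _) (sumℤ-filter P? g xs)

pairSum-pairs : ∀ {n} (f : Fin n → Fin n → ℤ) → pairSum f ≡ sumℤ (map (uncurry f) (pairs n))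
pairSum-pairs {n} f =
  trans (cong sumℤ (rows (allFin n)))
    (sumℤ-filter (λ e → proj₁ e Finₚ.<? proj₂ e) (uncurry f) (cartesianProduct (allFin n) (allFin n)))
  where
  cell : Edge n → ℤ
  cell (i , j) = if ⌊ i Finₚ.<? j ⌋ then f i j else + 0
  rows : ∀ is → concatMap (λ i → map (λ j → cell (i , j)) (allFin n)) is ≡
    map cell (cartesianProduct is (allFin n))
  rows []       = refl
  rows (i ∷ is) =
    trans (cong₂ _++_ (map-∘ (allFin n)) (rows is)) (≡-sym (map-++ cell (map (i ,_) (allFin n)) _))

edges : ∀ {n} → (Fin n → Fin n → Bool) → List (Edge n)
edges {n} E = filter (λ e → uncurry E e Boolₚ.≟ true) (pairs n)

edges-unique : ∀ {n} (E : Fin n → Fin n → Bool) → Unique (edges E)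
edges-unique {n} E = Uniqueₚ.filter⁺ _ (pairs-unique n)

∈-edges⁺ : ∀ {n} {E : Fin n → Fin n → Bool} {i j} → i Fin.< j → E i j ≡ true → (i , j) ∈ edges E
∈-edges⁺ {E = E} i<j Eij = ∈-filter⁺ _ (∈-pairs⁺ i<j) Eij

∈-edges⁻ : ∀ {n} {E : Fin n → Fin n → Bool} {i j} → (i , j) ∈ edges E → i Fin.< j × E i j ≡ true
∈-edges⁻ {n} {E} ij∈ with ∈-filter⁻ _ {xs = pairs n} ij∈
... | ij∈pairs , Eij = ∈-pairs⁻ ij∈pairs , Eij

Adj⇒edge : ∀ {n} {E : Fin n → Fin n → Bool} {u v} → Adj E u v → (u , v) ∈ edges E ⊎ (v , u) ∈ edges E
Adj⇒edge = Sum.map (uncurry ∈-edges⁺) (uncurry ∈-edges⁺)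

walk⇒reach : ∀ {n} {E : Fin n → Fin n → Bool} {u v} → Walk E u v → Reach (edges E) u v
walk⇒reach here       = stay
walk⇒reach (step e p) = move (Adj⇒edge e) (walk⇒reach p)

reach⇒walk : ∀ {n} {E : Fin n → Fin n → Bool} {u v} → Reach (edges E) u v → Walk E u v
reach⇒walk stay       = here
reach⇒walk (move e p) = step (Sum.map ∈-edges⁻ ∈-edges⁻ e) (reach⇒walk p)

edgeCount-edges : ∀ {n} (E : Fin n → Fin n → Bool) → edgeCount E ≡ + length (edges E)
edgeCount-edges {n} E = trans (pairSum-pairs (λ i j → if E i j then + 1 else + 0)) (go (pairs n))
  where
  go : ∀ es → sumℤ (map (uncurry (λ i j → if E i j then + 1 else + 0)) es) ≡
    + count (λ e → uncurry E e Boolₚ.≟ true) es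
  go [] = refl
  go ((i , j) ∷ es) with E i j
  ... | true  = cong (ℤ._+_ (+ 1)) (go es)
  ... | false = trans (ℤₚ.+-identityˡ _) (go es)

Negative : ∀ {n} → (Fin n → Fin n → Sign) → Pred (Edge n) _
Negative w (i , j) = w i j ≡ Sign.-

negative? : ∀ {n} (w : Fin n → Fin n → Sign) → Decidable (Negative w)
negative? w (i , j) = w i j Signₚ.≟ Sign.-

neg pos : ∀ {n} → (Fin n → Fin n → Sign) → List (Edge n) → List (Edge n)
neg w = filter (negative? w)
pos w = filter (¬? ∘ negative? w)

length-neg-pos : ∀ {n} (w : Fin n → Fin n → Sign) es → length es ≡ length (neg w es) + length (pos w es)
length-neg-pos w = count-+-¬ (negative? w)

weightOn-edges : ∀ (G : Graph) w E →
  weightOn G w E ≡ + length (pos w (edges E)) ℤ.- + length (neg w (edges E))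
weightOn-edges G w E = trans (pairSum-pairs (λ i j → if E i j then w i j ℤ.◃ 1 else + 0)) (go (pairs _))
  where
  E? = λ (e : Edge (n G)) → uncurry E e Boolₚ.≟ true
  go : ∀ es → sumℤ (map (uncurry (λ i j → if E i j then w i j ℤ.◃ 1 else + 0)) es) ≡
    + length (pos w (filter E? es)) ℤ.- + length (neg w (filter E? es))
  go [] = refl
  go ((i , j) ∷ es) with E i j
  ... | false = trans (ℤₚ.+-identityˡ _) (go es)
  ... | true with w i j
  ...   | Sign.+ = trans (cong (ℤ._+_ (+ 1)) (go es))
    (≡-sym (ℤₚ.+-assoc (+ 1) (+ length (pos w (filter E? es))) (ℤ.- + length (neg w (filter E? es)))))
  ...   | Sign.- = trans (cong (ℤ._+_ -[1+ 0 ]) (go es))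
    (arith (+ length (pos w (filter E? es))) (+ length (neg w (filter E? es))))
    where
    arith : ∀ p q → -[1+ 0 ] ℤ.+ (p ℤ.- q) ≡ p ℤ.- (+ 1 ℤ.+ q)
    arith = ℤS.solve-∀

-- Components and connected edge sets

-- `size-bound` holds because an edge merges at most two classes. It is the source of three
-- estimates: n ≤ |E| + 1 in a connected graph, s ≤ P + 1 for s contracted vertices, and n ≤ s + N.
record Components {n} (F : List (Edge n)) : Set where
  field
    size       : ℕ
    class      : Fin n → Fin size
    surjective : ∀ c → ∃ λ u → class u ≡ c
    reach      : ∀ {u v} → class u ≡ class v → Reach F u v
    edge       : ∀ {u v} → (u , v) ∈ F → class u ≡ class v
    size-bound : n ≤ size + length F

module _ {s : ℕ} {c d : Fin (suc s)} (d≢c : d ≢ c) where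

  -- The class `d` is glued to `c` and its number is removed, so exactly one class disappears.
  identify : Fin (suc s) → Fin s
  identify x with d Finₚ.≟ x
  ... | yes _  = Fin.punchOut d≢c
  ... | no d≢x = Fin.punchOut d≢x

  identify-≡ : identify c ≡ identify d
  identify-≡ with d Finₚ.≟ c | d Finₚ.≟ d
  ... | yes _   | yes _  = refl
  ... | no _    | yes _  = Finₚ.punchOut-cong d refl
  ... | _       | no d≢d = contradiction refl d≢d

  identify-surjective : ∀ y → ∃ λ x → identify x ≡ y
  identify-surjective y = Fin.punchIn d y , eq
    where
    eq : identify (Fin.punchIn d y) ≡ y
    eq with d Finₚ.≟ Fin.punchIn d y
    ... | yes d≡ = contradiction (≡-sym d≡) (Finₚ.punchInᵢ≢i d y)
    ... | no _   = trans (Finₚ.punchOut-cong d refl) (Finₚ.punchOut-punchIn d)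

  identify-injective : ∀ x y → identify x ≡ identify y →
    x ≡ y ⊎ (x ≡ c × y ≡ d) ⊎ (x ≡ d × y ≡ c)
  identify-injective x y eq with d Finₚ.≟ x | d Finₚ.≟ y
  ... | yes d≡x | yes d≡y = inj₁ (trans (≡-sym d≡x) d≡y)
  ... | yes d≡x | no d≢y  = inj₂ (inj₂ (≡-sym d≡x , ≡-sym (Finₚ.punchOut-injective d≢c d≢y eq)))
  ... | no d≢x  | yes d≡y = inj₂ (inj₁ (Finₚ.punchOut-injective d≢x d≢c eq , ≡-sym d≡y))
  ... | no d≢x  | no d≢y  = inj₁ (Finₚ.punchOut-injective d≢x d≢y eq)

components : ∀ {n} (F : List (Edge n)) → Components F
components {n} [] = record
  { size       = n
  ; class      = id
  ; surjective = λ c → c , refl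
  ; reach      = λ { refl → stay }
  ; edge       = λ ()
  ; size-bound = ≤-reflexive (≡-sym (+-identityʳ n))
  }
components {n} ((a , b) ∷ F) = extend (components F)
  where
  extend : Components F → Components ((a , b) ∷ F)
  extend K with Components.class K b Finₚ.≟ Components.class K a
  ... | yes b≡a = record
    { size       = size
    ; class      = class
    ; surjective = surjective
    ; reach      = reach-⊆ there ∘ reach
    ; edge       = λ { (here refl) → ≡-sym b≡a ; (there e) → edge e }
    ; size-bound = ≤-trans size-bound (+-monoʳ-≤ size (n≤1+n _))
    }
    where open Components K
  extend record { size = suc s ; class = class ; surjective = surjective ; reach = reach
                ; edge = edge ; size-bound = size-bound } | no b≢a = record
    { size       = s
    ; class      = identify b≢a ∘ class
    ; surjective = λ y → let x , x≡y = identify-surjective b≢a y ; u , u≡x = surjective x in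
        u , trans (cong (identify b≢a) u≡x) x≡y
    ; reach      = λ {u} {v} eq → join (identify-injective b≢a (class u) (class v) eq)
    ; edge       = λ { (here refl) → identify-≡ b≢a ; (there e) → cong (identify b≢a) (edge e) }
    ; size-bound = ≤-trans size-bound (≤-reflexive (≡-sym (+-suc s (length F))))
    }
    where
    join : ∀ {u v} → class u ≡ class v ⊎ (class u ≡ class a × class v ≡ class b) ⊎
      (class u ≡ class b × class v ≡ class a) → Reach ((a , b) ∷ F) u v
    join (inj₁ u≡v) = reach-⊆ there (reach u≡v)
    join (inj₂ (inj₁ (u≡a , v≡b))) =
      reach-++ (reach-⊆ there (reach u≡a)) (move (inj₁ (here refl)) (reach-⊆ there (reach (≡-sym v≡b))))
    join (inj₂ (inj₂ (u≡b , v≡a))) =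
      reach-++ (reach-⊆ there (reach u≡b)) (move (inj₂ (here refl)) (reach-⊆ there (reach (≡-sym v≡a))))
  extend record { size = zero ; class = class } | no _ = case class a of λ ()

components-connected : ∀ {n} {F : List (Edge n)} (K : Components F) → (∀ u v → Reach F u v) →
  Components.size K ≤ 1
components-connected {F = F} K conn = at-most-one surjective λ u v → constant (conn u v)
  where
  open Components K
  constant : ∀ {u v} → Reach F u v → class u ≡ class v
  constant stay              = refl
  constant (move (inj₁ e) p) = trans (edge e) (constant p)
  constant (move (inj₂ e) p) = trans (≡-sym (edge e)) (constant p)
  at-most-one : ∀ {m t} {f : Fin m → Fin t} → (∀ c → ∃ λ u → f u ≡ c) → (∀ u v → f u ≡ f v) → t ≤ 1
  at-most-one {t = zero}        sur const′ = z≤n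
  at-most-one {t = suc zero}    sur const′ = ≤-refl
  at-most-one {t = suc (suc _)} sur const′ with sur Fin.zero | sur (Fin.suc Fin.zero)
  ... | u , fu≡0 | v , fv≡1 = case trans (≡-sym fu≡0) (trans (const′ u v) fv≡1) of λ ()

-- The root is always included, so that the empty edge set has a vertex from which to grow.
vertices : ∀ {n} → Fin n → List (Edge n) → List (Fin n)
vertices r []            = r ∷ []
vertices r ((u , v) ∷ g) = u ∷ v ∷ vertices r g

root-∈ : ∀ {n} {r : Fin n} g → r ∈ vertices r g
root-∈ []      = here refl
root-∈ (e ∷ g) = there (there (root-∈ g))

∈-vertices : ∀ {n} {r u v : Fin n} {g} → (u , v) ∈ g → u ∈ vertices r g × v ∈ vertices r g
∈-vertices (here refl) = here refl , there (here refl)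
∈-vertices (there e) with ∈-vertices e
... | u∈ , v∈ = there (there u∈) , there (there v∈)

-- Edge sets of connected subgraphs containing r, listed so that removing the head keeps them connected.
data Growing {n} (r : Fin n) : List (Edge n) → Set where
  []   : Growing r []
  grow : ∀ {u v g} → (u , v) ∉ g → u ∈ vertices r g ⊎ v ∈ vertices r g →
    Growing r g → Growing r ((u , v) ∷ g)

growing-unique : ∀ {n} {r : Fin n} {g} → Growing r g → Unique g
growing-unique []               = []
growing-unique (grow e∉g _ gr) = unique-∷ e∉g (growing-unique gr)

growing-reach : ∀ {n} {r : Fin n} {g} → Growing r g → ∀ {v} → v ∈ vertices r g → Reach g r v
growing-reach [] (here refl) = stay
growing-reach (grow _ t gr) (here refl) with t
... | inj₁ u∈ = reach-⊆ there (growing-reach gr u∈)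
... | inj₂ v∈ = reach-++ (reach-⊆ there (growing-reach gr v∈)) (move (inj₂ (here refl)) stay)
growing-reach (grow _ t gr) (there (here refl)) with t
... | inj₁ u∈ = reach-++ (reach-⊆ there (growing-reach gr u∈)) (move (inj₁ (here refl)) stay)
... | inj₂ v∈ = reach-⊆ there (growing-reach gr v∈)
growing-reach (grow _ _ gr) (there (there x∈)) = reach-⊆ there (growing-reach gr x∈)

module _ {n} {r : Fin n} {F : List (Edge n)} (spanned : ∀ {u v} → (u , v) ∈ F → Reach F r u) where

  -- If `u` is not yet covered, the walk in `F` from `r` to `u` leaves the covered vertices. The
  -- edge where it does so touches `g`, and it is new because its other end is uncovered.
  touching : ∀ {g} → Growing r g → ∀ {u v} → (u , v) ∈ F → (u , v) ∉ g →
    ∃ λ e → e ∈ F × Growing r (e ∷ g)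
  touching {g} gr {u} {v} e∈F e∉g with u ∈ᶠ? vertices r g
  ... | yes u∈ = (u , v) , e∈F , grow e∉g (inj₁ u∈) gr
  ... | no u∉ with reach-exit (_∈ᶠ? vertices r g) (spanned e∈F) (root-∈ g) u∉
  ...   | x , y , inj₁ xy , x∈ , y∉ = _ , xy , grow (y∉ ∘ proj₂ ∘ ∈-vertices) (inj₁ x∈) gr
  ...   | x , y , inj₂ yx , x∈ , y∉ = _ , yx , grow (y∉ ∘ proj₁ ∘ ∈-vertices) (inj₂ x∈) gr

  -- The final alternative records why growth ended: all `m` edges were added, or `F` was used up.
  grow-by : ∀ m {g} → Growing r g → g ⊆ F →
    ∃ λ h → Growing r h × h ⊆ F × g ⊆ h × length h ≤ m + length g × (length h ≡ m + length g ⊎ F ⊆ h)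
  grow-by zero {g} gr g⊆F = g , gr , g⊆F , id , ≤-refl , inj₁ refl
  grow-by (suc m) {g} gr g⊆F with All.all? (_∈ᵉ? g) F
  ... | yes F⊆g = g , gr , g⊆F , id , m≤n+m _ (suc m) , inj₂ (All.lookup F⊆g)
  ... | no F⊈g with find-∉ F (Allₚ.¬All⇒Any¬ (_∈ᵉ? g) F F⊈g)
    where
    find-∉ : ∀ es → Any (_∉ g) es → ∃ λ e → e ∈ es × e ∉ g
    find-∉ (e ∷ es) (here e∉)  = e , here refl , e∉
    find-∉ (e ∷ es) (there e∉) = map₂ (λ (e∈ , e∉g) → there e∈ , e∉g) (find-∉ es e∉)
  ... | e , e∈F , e∉g with touching gr e∈F e∉g
  ... | e′ , e′∈F , gr′ with grow-by m gr′ (λ { (here refl) → e′∈F ; (there x∈) → g⊆F x∈ })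
  ... | h , grh , h⊆F , eg⊆h , h≤ , stop =
    h , grh , h⊆F , eg⊆h ∘ there , ≤-trans h≤ (≤-reflexive (+-suc m (length g))) ,
      Sum.map₁ (λ eq → trans eq (+-suc m (length g))) stop

  grow-to : ∀ k {g} → Growing r g → g ⊆ F → Unique F → length g ≤ k → k ≤ length F →
    ∃ λ h → Growing r h × h ⊆ F × g ⊆ h × length h ≡ k
  grow-to k {g} gr g⊆F F! g≤k k≤F with grow-by (k ∸ length g) gr g⊆F
  ... | h , grh , h⊆F , g⊆h , h≤ , inj₁ eq = h , grh , h⊆F , g⊆h , trans eq (m∸n+n≡m g≤k)
  ... | h , grh , h⊆F , g⊆h , h≤ , inj₂ F⊆h = h , grh , h⊆F , g⊆h ,
    ≤-antisym (≤-trans h≤ (≤-reflexive (m∸n+n≡m g≤k))) (≤-trans k≤F (unique-⊆-length F! F⊆h))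

  grow-all : ∃ λ h → Growing r h × h ⊆ F × F ⊆ h
  -- One edge more than `F` has cannot be added, so growth can end only by using up `F`.
  grow-all with grow-by (suc (length F)) [] (λ ())
  ... | h , gr , h⊆F , _ , _ , inj₂ F⊆h = h , gr , h⊆F , F⊆h
  ... | h , gr , h⊆F , _ , _ , inj₁ eq = contradiction (unique-⊆-length (growing-unique gr) h⊆F)
    (<⇒≱ (≤-trans (≤-reflexive (cong suc (≡-sym (+-identityʳ _)))) (≤-reflexive (≡-sym eq))))

-- Local positivity for edge lists

⌊⌋-true⁺ : ∀ {P : Set} (P? : Dec P) → P → ⌊ P? ⌋ ≡ true
⌊⌋-true⁺ (yes _) p = refl
⌊⌋-true⁺ (no ¬p) p = contradiction p ¬p

⌊⌋-true⁻ : ∀ {P : Set} (P? : Dec P) → ⌊ P? ⌋ ≡ true → P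
⌊⌋-true⁻ (yes p) _ = p

neg-⊆ : ∀ {n} (w : Fin n → Fin n → Sign) {g h} → g ⊆ h → neg w g ⊆ neg w h
neg-⊆ w {g} g⊆h e∈ with ∈-filter⁻ (negative? w) {xs = g} e∈
... | e∈g , e- = ∈-filter⁺ (negative? w) (g⊆h e∈g) e-

pos-⊆ : ∀ {n} (w : Fin n → Fin n → Sign) {g h} → g ⊆ h → pos w g ⊆ pos w h
pos-⊆ w {g} g⊆h e∈ with ∈-filter⁻ (¬? ∘ negative? w) {xs = g} e∈
... | e∈g , e+ = ∈-filter⁺ (¬? ∘ negative? w) (g⊆h e∈g) e+

neg-unique : ∀ {n} (w : Fin n → Fin n → Sign) {g} → Unique g → Unique (neg w g)
neg-unique w = Uniqueₚ.filter⁺ (negative? w)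

pos-unique : ∀ {n} (w : Fin n → Fin n → Sign) {g} → Unique g → Unique (pos w g)
pos-unique w = Uniqueₚ.filter⁺ (¬? ∘ negative? w)

module _ {G : Graph} {r : Fin (n G)} {g} (gr : Growing r g) (g⊆ : g ⊆ edges (adj G)) where

  spanSubgraph : Subgraph G
  spanSubgraph = record
    { vs  = λ v → ⌊ v ∈ᶠ? vertices r g ⌋
    ; es  = λ i j → ⌊ (i , j) ∈ᵉ? g ⌋
    ; sub = λ i j i<j ij∈ → let e∈g = ⌊⌋-true⁻ ((i , j) ∈ᵉ? g) ij∈ ; i∈ , j∈ = ∈-vertices e∈g in
        proj₂ (∈-edges⁻ (g⊆ e∈g)) , ⌊⌋-true⁺ (i ∈ᶠ? vertices r g) i∈ , ⌊⌋-true⁺ (j ∈ᶠ? vertices r g) j∈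
    }

  g⊆span : g ⊆ edges (es spanSubgraph)
  g⊆span {i , j} e∈g = ∈-edges⁺ (proj₁ (∈-edges⁻ (g⊆ e∈g))) (⌊⌋-true⁺ ((i , j) ∈ᵉ? g) e∈g)

  span⊆g : edges (es spanSubgraph) ⊆ g
  span⊆g {i , j} e∈ = ⌊⌋-true⁻ ((i , j) ∈ᵉ? g) (proj₂ (∈-edges⁻ e∈))

  span-connected : IsConnectedSub spanSubgraph
  span-connected =
    (r , ⌊⌋-true⁺ (r ∈ᶠ? vertices r g) (root-∈ g)) ,
    λ u v u∈ v∈ → reach⇒walk (reach-⊆ g⊆span (reach-++
      (reach-sym (growing-reach gr (⌊⌋-true⁻ (u ∈ᶠ? vertices r g) u∈)))
      (growing-reach gr (⌊⌋-true⁻ (v ∈ᶠ? vertices r g) v∈))))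

  -- Transfers local positivity to edge lists, through the subgraph whose edges are the members of
  -- `g`. Both lists are free of repetition, so their counts agree.
  growing-positive : ∀ {k w} → LocalPositive G k w → length g ≡ k →
    length (neg w g) < length (pos w g)
  growing-positive {k} {w} lp |g|≡k = ≰⇒> λ pos≤neg →
    ℤₚ.<⇒≱ (subst (ℤ._<_ (+ 0)) weight≡ (lp spanSubgraph span-connected count≡))
      (ℤₚ.i≤j⇒i-j≤0 (ℤ.+≤+ pos≤neg))
    where
    g! = growing-unique gr
    span! = edges-unique (es spanSubgraph)
    count≡ : edgeCount (es spanSubgraph) ≡ + k
    count≡ = trans (edgeCount-edges (es spanSubgraph)) (cong +_ (trans (unique-≡-length span! g! span⊆g g⊆span) |g|≡k))
    weight≡ : weightOn G w (es spanSubgraph) ≡ + length (pos w g) ℤ.- + length (neg w g)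
    weight≡ = trans (weightOn-edges G w _) (cong₂ (λ p m → + p ℤ.- + m)
      (unique-≡-length (pos-unique w span!) (pos-unique w g!) (pos-⊆ w span⊆g) (pos-⊆ w g⊆span))
      (unique-≡-length (neg-unique w span!) (neg-unique w g!) (neg-⊆ w span⊆g) (neg-⊆ w g⊆span)))

-- Removing the head preserves connectivity and loses at most one negative edge, so no value of the
-- count is skipped on the way down.
trim : ∀ {n} {r : Fin n} (w : Fin n → Fin n → Sign) b {g} → Growing r g → b ≤ length (neg w g) →
  ∃ λ h → Growing r h × h ⊆ g × length (neg w h) ≡ b
trim w zero    {[]} [] z≤n = [] , [] , id , refl
trim w b {e ∷ g} gr@(grow _ _ gr′) b≤ with b ℕₚ.≟ length (neg w (e ∷ g))
... | yes refl = e ∷ g , gr , id , refl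
... | no b≢ = let h , grh , h⊆ , eq = trim w b gr′ (b≤tail (negative? w e)) in h , grh , there ∘ h⊆ , eq
  where
  b<  = ≤∧≢⇒< b≤ b≢
  b≤tail : Dec (Negative w e) → b ≤ length (neg w g)
  b≤tail (yes e-) = s≤s⁻¹ (subst (λ xs → b < length xs) (filter-accept (negative? w) e-) b<)
  b≤tail (no e+)  = <⇒≤ (subst (λ xs → b < length xs) (filter-reject (negative? w) e+) b<)

connected-spanned : ∀ {G} → IsConnected G → ∀ r {u} → Reach (edges (adj G)) r u
connected-spanned (_ , walks) r = walk⇒reach (walks r _)

-- Otherwise trim to a + 1 negative edges; with all positive edges of `g` these are still at most
-- `k` edges. Extended to exactly `k`, the set has at least a + 1 negative and therefore more than a
-- + 1 positive edges, more than 2a + 2 ≥ k in total.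
few-negatives : ∀ {G k w a} → IsConnected G → LocalPositive G k w → k ≤ length (edges (adj G)) →
  k ≤ suc a + suc a → ∀ {r g} → Growing r g → g ⊆ edges (adj G) → suc a + length (pos w g) ≤ k →
  length (neg w g) ≤ a
few-negatives {G} {k} {w} {a} conn lp k≤E k≤2a {r} {g} gr g⊆ pos≤ = ≮⇒≥ λ a<neg →
  let h , grh , h⊆g , neg≡ = trim w (suc a) gr a<neg
      |h|≤k = begin
        length h                           ≡⟨ length-neg-pos w h ⟩
        length (neg w h) + length (pos w h) ≤⟨ +-mono-≤ (≤-reflexive neg≡)
          (unique-⊆-length (pos-unique w (growing-unique grh)) (pos-⊆ w h⊆g)) ⟩
        suc a + length (pos w g)           ≤⟨ pos≤ ⟩
        k                                  ∎
      l , grl , l⊆ , h⊆l , |l|≡k = grow-to (λ _ → connected-spanned {G} conn r) k grh (g⊆ ∘ h⊆g)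
        (edges-unique (adj G)) |h|≤k k≤E
      a<negl = begin
        suc a            ≡⟨ neg≡ ⟨
        length (neg w h) ≤⟨ unique-⊆-length (neg-unique w (growing-unique grh)) (neg-⊆ w h⊆l) ⟩
        length (neg w l) ∎
  in <⇒≱ (begin-strict
       suc a + suc a                       ≤⟨ +-monoʳ-≤ (suc a) a<negl ⟩
       suc a + length (neg w l)            <⟨ +-monoʳ-< (suc a) (growing-positive {G} grl l⊆ lp |l|≡k) ⟩
       suc a + length (pos w l)            ≤⟨ +-monoˡ-≤ _ a<negl ⟩
       length (neg w l) + length (pos w l) ≡⟨ length-neg-pos w l ⟨
       length l                            ≡⟨ |l|≡k ⟩
       k ∎) k≤2a
  where open ≤-Reasoning

-- Contracting the negative edges

Linkᴾ : ∀ {s} → List (Edge s) → Fin s → Fin s → Set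
Linkᴾ links c d = (c , d) ∈ links ⊎ (d , c) ∈ links

-- The graph obtained by contracting the components of the negative edges: wt counts the negative
-- edges inside a component, links are the positive edges.
record Contraction (n N P a q : ℕ) : Set where
  field
    size      : ℕ
    wt        : Fin size → ℕ
    links     : List (Edge size)
    nonempty  : Fin size
    connected : ∀ c d → Reach links c d
    size≤     : size ≤ suc P
    n≤        : n ≤ size + N
    N≤        : N ≤ sum (map wt (allFin size))
    -- A walk `L` may repeat vertices, so weights are summed over a repetition-free `M`. Allowing
    -- any sublist lets a long walk be cut up without counting a vertex twice.
    light     : ∀ {L M} → Linked (Linkᴾ links) L → length L ≤ q → Unique M → M ⊆ L →
      sum (map wt M) ≤ a

module _ (G : Graph) (w : Weighing G) {k a q : ℕ} (conn : IsConnected G) (lp : LocalPositive G k w)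
  (k≤E : k ≤ length (edges (adj G))) (k≤2a : k ≤ suc a + suc a) (a+q≤k : a + q ≤ k) where

  private
    E⁻ E⁺ : List (Edge (n G))
    E⁻ = neg w (edges (adj G))
    E⁺ = pos w (edges (adj G))

    K : Components E⁻
    K = components E⁻

    open Components K renaming (reach to class-reach)

    links′ : List (Edge size)
    links′ = map (λ (u , v) → class u , class v) E⁺

    bucket : Fin size → List (Edge (n G))
    bucket c = filter (λ e → class (proj₁ e) Finₚ.≟ c) E⁻

    bucket-unique : ∀ c → Unique (bucket c)
    bucket-unique c = Uniqueₚ.filter⁺ _ (neg-unique w (edges-unique (adj G)))

    bucket-∈ : ∀ {c e} → e ∈ bucket c → e ∈ E⁻ × class (proj₁ e) ≡ c
    bucket-∈ = ∈-filter⁻ _ {xs = E⁻}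

    E⁻⊆ : E⁻ ⊆ edges (adj G)
    E⁻⊆ = proj₁ ∘ ∈-filter⁻ (negative? w) {xs = edges (adj G)}

    E⁻-negative : ∀ {e} → e ∈ E⁻ → Negative w e
    E⁻-negative = proj₂ ∘ ∈-filter⁻ (negative? w) {xs = edges (adj G)}

    E⁺⊆ : E⁺ ⊆ edges (adj G)
    E⁺⊆ = proj₁ ∘ ∈-filter⁻ (¬? ∘ negative? w) {xs = edges (adj G)}

    links-connected : ∀ c d → Reach links′ c d
    links-connected c d with surjective c | surjective d
    ... | u , refl | v , refl = reach-bind class edge-link (walk⇒reach (proj₂ conn u v))
      where
      edge-link : ∀ {u v} → (u , v) ∈ edges (adj G) → Reach links′ (class u) (class v)
      edge-link {u} {v} e∈ with negative? w (u , v)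
      ... | yes e- = subst (Reach links′ (class u)) (edge (∈-filter⁺ (negative? w) e∈ e-)) stay
      ... | no e+  = move (inj₁ (∈-map⁺ _ (∈-filter⁺ (¬? ∘ negative? w) e∈ e+))) stay

    size≤1+P : size ≤ suc (length E⁺)
    size≤1+P = ≤-trans (Components.size-bound (components links′))
      (+-mono-≤ (components-connected (components links′) links-connected) (≤-reflexive (length-map _ E⁺)))

    -- A negative walk never leaves its class, so only the negative edges of that class are needed
    -- in `F`.
    class-reach-in : ∀ {F u v} → Reach E⁻ u v → (∀ {e} → e ∈ E⁻ → class (proj₁ e) ≡ class u → e ∈ F) →
      Reach F u v
    class-reach-in stay              ⊆F = stay
    class-reach-in (move (inj₁ e) p) ⊆F =
      move (inj₁ (⊆F e refl)) (class-reach-in p λ e′ eq → ⊆F e′ (trans eq (≡-sym (edge e))))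
    class-reach-in (move (inj₂ e) p) ⊆F =
      move (inj₂ (⊆F e (edge e))) (class-reach-in p λ e′ eq → ⊆F e′ (trans eq (edge e)))

    -- Quantifying over every larger `F` lets the same connectors serve again when the walk is
    -- extended at its front.
    Joins : List (Edge (n G)) → List (Fin size) → Set
    Joins C L = ∀ {F} → C ⊆ F → (∀ {e} → e ∈ E⁻ → class (proj₁ e) ∈ L → e ∈ F) →
      ∀ {u v} → class u ∈ L → class v ∈ L → Reach F u v

    within : ∀ {F c L u v} → (∀ {e} → e ∈ E⁻ → class (proj₁ e) ∈ c ∷ L → e ∈ F) →
      class u ≡ c → class v ≡ c → Reach F u v
    within E⁻⊆F refl v≡c = class-reach-in (class-reach (≡-sym v≡c)) λ e∈ eq → E⁻⊆F e∈ (here eq)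

    crossing : ∀ {c d} → Linkᴾ links′ c d →
      ∃ λ e → e ∈ E⁺ × ∃₂ λ u v → (e ≡ (u , v) ⊎ e ≡ (v , u)) × class u ≡ c × class v ≡ d
    crossing (inj₁ cd∈) with ∈-map⁻ _ cd∈
    ... | (u , v) , e∈ , refl = (u , v) , e∈ , u , v , inj₁ refl , refl , refl
    crossing (inj₂ dc∈) with ∈-map⁻ _ dc∈
    ... | (u , v) , e∈ , refl = (u , v) , e∈ , v , u , inj₂ refl , refl , refl

    -- One positive edge is chosen per step of the walk; classes are connected internally by their
    -- negative edges. The q vertices of a walk thus cost only q - 1 positive edges.
    connectors : ∀ c L → Linked (Linkᴾ links′) (c ∷ L) →
      ∃ λ C → C ⊆ E⁺ × length C ≤ length L × (∀ {e} → e ∈ C → class (proj₁ e) ∈ c ∷ L) × Joins C (c ∷ L)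
    connectors c [] [-] = [] , (λ ()) , z≤n , (λ ()) , λ { _ E⁻⊆F (here u≡) (here v≡) → within E⁻⊆F u≡ v≡ }
    connectors c (d ∷ L) (cd ∷ lk) with connectors d L lk | crossing cd
    ... | C , C⊆ , |C|≤ , C-class , joins | e , e∈ , u₀ , v₀ , e≡ , u₀≡c , v₀≡d =
      e ∷ C , (λ { (here refl) → e∈ ; (there x∈) → C⊆ x∈ }) , s≤s |C|≤ ,
      (λ { (here refl) → e-class e≡ ; (there x∈) → there (C-class x∈) }) , joins′
      where
      e-class : e ≡ (u₀ , v₀) ⊎ e ≡ (v₀ , u₀) → class (proj₁ e) ∈ c ∷ d ∷ L
      e-class (inj₁ refl) = here u₀≡c
      e-class (inj₂ refl) = there (here v₀≡d)
      cross : ∀ {F} → e ∈ F → e ≡ (u₀ , v₀) ⊎ e ≡ (v₀ , u₀) → Reach F u₀ v₀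
      cross e∈F (inj₁ refl) = move (inj₁ e∈F) stay
      cross e∈F (inj₂ refl) = move (inj₂ e∈F) stay
      joins′ : Joins (e ∷ C) (c ∷ d ∷ L)
      joins′ {F} eC⊆F E⁻⊆F = λ where
          (here u≡)  (here v≡)  → within E⁻⊆F u≡ v≡
          (here u≡)  (there v∈) → from-c u≡ v∈
          (there u∈) (here v≡)  → reach-sym (from-c v≡ u∈)
          (there u∈) (there v∈) → rest u∈ v∈
        where
        rest : ∀ {u v} → class u ∈ d ∷ L → class v ∈ d ∷ L → Reach F u v
        rest = joins (eC⊆F ∘ there) (λ e∈ cl∈ → E⁻⊆F e∈ (there cl∈))
        from-c : ∀ {u v} → class u ≡ c → class v ∈ d ∷ L → Reach F u v
        from-c u≡ v∈ = reach-++ (within E⁻⊆F u≡ u₀≡c)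
          (reach-++ (cross (eC⊆F (here refl)) e≡) (rest (here v₀≡d) v∈))

    -- The connectors and all negative edges inside the visited classes form a connected edge set
    -- with fewer than `q` positive edges, to which `few-negatives` applies.
    light′ : ∀ {L M} → Linked (Linkᴾ links′) L → length L ≤ q → Unique M → M ⊆ L →
      sum (map (length ∘ bucket) M) ≤ a
    light′ {[]} {[]}    _ _ _ _  = z≤n
    light′ {[]} {x ∷ M} _ _ _ M⊆ = case M⊆ (here refl) of λ ()
    light′ {c ∷ L} {M} lk |L|≤q M! M⊆ with connectors c L lk | surjective c
    ... | C , C⊆ , |C|≤ , C-class , joins | r , r≡c = begin
      sum (map (length ∘ bucket) M)  ≡⟨ length-concatMap bucket M ⟨
      length (concatMap bucket M)    ≤⟨ unique-⊆-length buckets! buckets⊆ ⟩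
      length (neg w g)               ≤⟨ few-negatives conn lp k≤E k≤2a gr (F⊆E ∘ g⊆F) pos≤ ⟩
      a                              ∎
      where
      open ≤-Reasoning
      inL? : Decidable λ (e : Edge (n G)) → class (proj₁ e) ∈ c ∷ L
      inL? e = class (proj₁ e) ∈ᶠ? (c ∷ L)
      F = filter inL? E⁻ ++ C
      F⊆E : F ⊆ edges (adj G)
      F⊆E = [ E⁻⊆ ∘ proj₁ ∘ ∈-filter⁻ inL? {xs = E⁻} , E⁺⊆ ∘ C⊆ ]′ ∘ ∈-++⁻ (filter inL? E⁻)
      F-class : ∀ {e} → e ∈ F → class (proj₁ e) ∈ c ∷ L
      F-class = [ proj₂ ∘ ∈-filter⁻ inL? {xs = E⁻} , C-class ]′ ∘ ∈-++⁻ (filter inL? E⁻)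
      F-spanned : ∀ {u v} → (u , v) ∈ F → Reach F r u
      F-spanned e∈F = joins (∈-++⁺ʳ (filter inL? E⁻)) (λ e∈ cl∈ → ∈-++⁺ˡ (∈-filter⁺ inL? e∈ cl∈))
        (here r≡c) (F-class e∈F)
      all-F = grow-all {r = r} {F} F-spanned
      g   = proj₁ all-F
      gr  = proj₁ (proj₂ all-F)
      g⊆F = proj₁ (proj₂ (proj₂ all-F))
      F⊆g = proj₂ (proj₂ (proj₂ all-F))
      pos⊆C : pos w g ⊆ C
      pos⊆C e∈ = let e∈g , e+ = ∈-filter⁻ (¬? ∘ negative? w) {xs = g} e∈ in
        [ (λ e∈⁻ → contradiction (E⁻-negative (proj₁ (∈-filter⁻ inL? {xs = E⁻} e∈⁻))) e+) , id ]′
          (∈-++⁻ (filter inL? E⁻) (g⊆F e∈g))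
      pos≤ : suc a + length (pos w g) ≤ k
      pos≤ = begin
        suc a + length (pos w g) ≤⟨ +-monoʳ-≤ (suc a) (unique-⊆-length (pos-unique w (growing-unique gr)) pos⊆C) ⟩
        suc a + length C         ≤⟨ +-monoʳ-≤ (suc a) |C|≤ ⟩
        suc a + length L         ≡⟨ +-suc a (length L) ⟨
        a + length (c ∷ L)       ≤⟨ +-monoʳ-≤ a |L|≤q ⟩
        a + q                    ≤⟨ a+q≤k ⟩
        k                        ∎
      buckets! : Unique (concatMap bucket M)
      buckets! = concatMap-unique M! bucket-unique
        λ e∈ e∈′ → trans (≡-sym (proj₂ (bucket-∈ e∈))) (proj₂ (bucket-∈ e∈′))
      buckets⊆ : concatMap bucket M ⊆ neg w g
      buckets⊆ e∈ =
        let d , d∈M , e∈d = ∈-concatMap⁻′ bucket e∈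
            e∈E⁻ , d≡     = bucket-∈ e∈d
        in ∈-filter⁺ (negative? w)
             (F⊆g (∈-++⁺ˡ (∈-filter⁺ inL? e∈E⁻ (subst (_∈ c ∷ L) (≡-sym d≡) (M⊆ d∈M)))))
             (E⁻-negative e∈E⁻)

  contraction : Contraction (n G) (length E⁻) (length E⁺) a q
  contraction = record
    { size      = size
    ; wt        = length ∘ bucket
    ; links     = links′
    ; nonempty  = class (proj₁ conn)
    ; connected = links-connected
    ; size≤     = size≤1+P
    ; n≤        = size-bound
    ; N≤        = ≤-trans
        (unique-⊆-length (neg-unique w (edges-unique (adj G)))
          λ {e} e∈ → ∈-concatMap (∈-allFin (class (proj₁ e))) (∈-filter⁺ _ e∈ refl))
        (≤-reflexive (length-concatMap bucket (allFin size)))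
    ; light     = light′
    }

-- Tours and charging

module _ {A : Set} where

  detour : ∀ {x L} → x ∈ L → A → List A
  detour {L = x ∷ L} (here _)  y = x ∷ y ∷ x ∷ L
  detour {L = z ∷ L} (there i) y = z ∷ detour i y

  length-detour : ∀ {x y L} (i : x ∈ L) → length (detour i y) ≡ 2 + length L
  length-detour (here _)  = refl
  length-detour (there i) = cong suc (length-detour i)

  ⊆-detour : ∀ {x y L} (i : x ∈ L) → y ∷ L ⊆ detour i y
  ⊆-detour (here _)  (here refl)         = there (here refl)
  ⊆-detour (here _)  (there z∈)          = there (there z∈)
  ⊆-detour (there i) (here refl)         = there (⊆-detour i (here refl))
  ⊆-detour (there i) (there (here refl)) = here refl
  ⊆-detour (there i) (there (there z∈))  = there (⊆-detour i (there z∈))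

  detour-⊆ : ∀ {x y L} (i : x ∈ L) → detour i y ⊆ y ∷ L
  detour-⊆ (here _)  (here refl)         = there (here refl)
  detour-⊆ (here _)  (there (here refl)) = here refl
  detour-⊆ (here _)  (there (there z∈))  = there z∈
  detour-⊆ (there i) (here refl)         = there (here refl)
  detour-⊆ (there i) (there z∈) with detour-⊆ i z∈
  ... | here refl = here refl
  ... | there z∈L = there (there z∈L)

module _ {A : Set} {R : A → A → Set} where

  linked-take : ∀ m {L} → Linked R L → Linked R (take m L)
  linked-take zero          lk        = []
  linked-take (suc m)       []        = []
  linked-take (suc zero)    [-]       = [-]
  linked-take (suc (suc m)) [-]       = [-]
  linked-take (suc zero)    (_ ∷ _)   = [-]
  linked-take (suc (suc m)) (r ∷ lk)  = r ∷ linked-take (suc m) lk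

  linked-drop : ∀ m {L} → Linked R L → Linked R (drop m L)
  linked-drop zero    lk       = lk
  linked-drop (suc m) []       = []
  linked-drop (suc m) [-]      = linked-drop m []
  linked-drop (suc m) (_ ∷ lk) = linked-drop m lk

  detour-linked : ∀ {x y L} (i : x ∈ L) → R x y → R y x → Linked R L → Linked R (detour i y)
  detour-linked (here refl)         xy yx lk        = xy ∷ yx ∷ lk
  detour-linked (there (here refl)) xy yx (zw ∷ lk) = zw ∷ xy ∷ yx ∷ lk
  detour-linked (there (there i))   xy yx (zw ∷ lk) = zw ∷ detour-linked (there i) xy yx lk

data Path {A : Set} (R : A → A → Set) : ℕ → A → A → Set where
  []  : ∀ {u} → Path R 0 u u
  _∷_ : ∀ {m u x v} → R u x → Path R m x v → Path R (suc m) u v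

module _ {A : Set} {R : A → A → Set} where

  path-++ : ∀ {i j u v w} → Path R i u v → Path R j v w → Path R (i + j) u w
  path-++ []      q = q
  path-++ (r ∷ p) q = r ∷ path-++ p q

  path-sym : (∀ {u v} → R u v → R v u) → ∀ {m u v} → Path R m u v → Path R m v u
  path-sym R-sym []              = []
  path-sym R-sym (_∷_ {m} {u} {_} {v} r p) =
    subst (λ l → Path R l v u) (+-comm m 1) (path-++ (path-sym R-sym p) (R-sym r ∷ []))

  path-linked : ∀ {m u v} → Path R m u v → ∃ λ L → Linked R (u ∷ L) × length L ≡ m × v ∈ u ∷ L
  path-linked []      = [] , [-] , refl , here refl
  path-linked (r ∷ p) with path-linked p
  ... | L , lk , |L|≡m , v∈ = _ ∷ L , r ∷ lk , cong suc |L|≡m , there v∈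

module _ {n N P a q} (X : Contraction n N P a q) where

  open Contraction X

  private
    Link = Linkᴾ links

    link-sym : ∀ {c d} → Link c d → Link d c
    link-sym = Sum.swap

    weight : List (Fin size) → ℕ
    weight = sum ∘ map wt

  exit : ∀ {c} S → c ∈ S → ∀ {d} → d ∉ S → ∃₂ λ x y → Link x y × x ∈ S × y ∉ S
  exit {c} S c∈S {d} d∉S = reach-exit (_∈ᶠ? S) (connected c d) c∈S d∉S

  find-∉ : ∀ S → (∀ c → c ∈ S) ⊎ ∃ (_∉ S)
  find-∉ S with Finₚ.all? (_∈ᶠ? S)
  ... | yes all∈ = inj₁ all∈
  ... | no ¬all∈ = inj₂ (Finₚ.¬∀⟶∃¬ size _ (_∈ᶠ? S) ¬all∈)

  -- A closed walk obtained by repeatedly inserting an excursion to a new vertex: each new vertex costs two steps.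
  tour-from : ∀ m {c U L} → Linked Link L → c ∈ L → Unique U → U ⊆ L → L ⊆ U →
    suc (length L) ≡ 2 * length U → size ≤ length U + m →
    ∃ λ T → Linked Link T × (∀ c → c ∈ T) × suc (length T) ≤ 2 * size
  tour-from m {c} {U} {L} lk c∈L U! U⊆L L⊆U |L| s≤ with find-∉ L
  ... | inj₁ all∈ = L , lk , all∈ , ≤-trans (≤-reflexive |L|) (*-monoʳ-≤ 2 (unique-length-Fin U!))
  ... | inj₂ (d , d∉L) with exit L c∈L d∉L
  ... | x , y , xy , x∈L , y∉L with unique-∷ (y∉L ∘ U⊆L) U!
  -- The bound on `m` says that `U` already has `size` distinct vertices, so there is no room for
  -- `y`.
  tour-from zero {U = U} lk c∈L U! U⊆L L⊆U |L| s≤ | inj₂ _ | x , y , xy , x∈L , y∉L | yU! =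
    contradiction (≤-trans (unique-length-Fin yU!) s≤) (<⇒≱ (s≤s (≤-reflexive (+-identityʳ _))))
  tour-from (suc m) {U = U} {L} lk c∈L U! U⊆L L⊆U |L| s≤ | inj₂ _ | x , y , xy , x∈L , y∉L | yU! =
    tour-from m (detour-linked x∈L xy (link-sym xy) lk) (⊆-detour x∈L (there c∈L)) yU!
      (λ { (here refl) → ⊆-detour x∈L (here refl) ; (there z∈) → ⊆-detour x∈L (there (U⊆L z∈)) })
      (λ z∈ → case detour-⊆ x∈L z∈ of λ { (here refl) → here refl ; (there z∈L) → there (L⊆U z∈L) })
      (trans (cong suc (length-detour x∈L)) (trans (cong (_+_ 2) |L|) (≡-sym (*-suc 2 (length U)))))
      (≤-trans s≤ (≤-reflexive (+-suc (length U) m)))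

  tour : ∃ λ T → Linked Link T × (∀ c → c ∈ T) × suc (length T) ≤ 2 * size
  tour = tour-from size {U = nonempty ∷ []} [-] (here refl) ([] ∷ []) id id refl (n≤1+n size)

  -- There are at most |L| / q + 1 pieces, each of weight at most `a`. A repeated vertex is charged
  -- to the first piece containing it and then removed from `M`.
  chunks : 1 ≤ q → ∀ m {L M} → length L ≤ m → Linked Link L → Unique M → M ⊆ L →
    q * weight M ≤ a * (length L + q)
  chunks 1≤q m {L} {M} |L|≤m lk M! M⊆L with length L ≤? q
  ... | yes |L|≤q = begin
    q * weight M       ≤⟨ *-monoʳ-≤ q (light lk |L|≤q M! M⊆L) ⟩
    q * a              ≡⟨ *-comm q a ⟩
    a * q              ≤⟨ *-monoʳ-≤ a (m≤n+m q (length L)) ⟩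
    a * (length L + q) ∎
    where open ≤-Reasoning
  chunks 1≤q zero |L|≤m lk M! M⊆L | no |L|≰q = contradiction (≤-trans |L|≤m z≤n) |L|≰q
  chunks 1≤q (suc m) {L} {M} |L|≤m lk M! M⊆L | no |L|≰q = begin
    q * weight M                               ≡⟨ cong (q *_) (sum-filter-split front? wt M) ⟩
    q * (weight M₁ + weight M₂)                ≡⟨ *-distribˡ-+ q (weight M₁) (weight M₂) ⟩
    q * weight M₁ + q * weight M₂              ≤⟨ +-mono-≤
      (*-monoʳ-≤ q (light (linked-take q lk) |take|≤q (Uniqueₚ.filter⁺ front? M!)
        (λ c∈ → proj₂ (∈-filter⁻ front? {xs = M} c∈))))
      (chunks 1≤q m |drop|≤m (linked-drop q lk) (Uniqueₚ.filter⁺ (¬? ∘ front?) M!) M₂⊆) ⟩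
    q * a + a * (length (drop q L) + q)        ≡⟨ cong (λ l → q * a + a * (l + q)) (length-drop q L) ⟩
    q * a + a * (length L ∸ q + q)             ≡⟨ cong (λ l → q * a + a * l) (m∸n+n≡m (<⇒≤ (≰⇒> |L|≰q))) ⟩
    q * a + a * length L                       ≡⟨ rearrange q a (length L) ⟩
    a * (length L + q)                         ∎
    where
    open ≤-Reasoning
    front? : Decidable (_∈ take q L)
    front? c = c ∈ᶠ? take q L
    M₁ = filter front? M
    M₂ = filter (¬? ∘ front?) M
    |take|≤q : length (take q L) ≤ q
    |take|≤q = ≤-trans (≤-reflexive (length-take q L)) (m⊓n≤m q _)
    |drop|≤m : length (drop q L) ≤ m
    |drop|≤m = ≤-trans (≤-reflexive (length-drop q L)) (≤-trans (∸-mono |L|≤m 1≤q) ≤-refl)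
    M₂⊆ : M₂ ⊆ drop q L
    M₂⊆ c∈ = let c∈M , c∉front = ∈-filter⁻ (¬? ∘ front?) {xs = M} c∈ in
      [ ⊥-elim ∘ c∉front , id ]′ (∈-++⁻ (take q L) (subst (_ ∈_) (≡-sym (take++drop≡id q L)) (M⊆L c∈M)))
    rearrange : ∀ q a l → q * a + a * l ≡ a * (l + q)
    rearrange = solve-∀

  tour-bound : 1 ≤ q → q * N ≤ a * (suc (2 * P) + q)
  tour-bound 1≤q with tour
  ... | T , lk , all∈ , |T|≤ = begin
    q * N                      ≤⟨ *-monoʳ-≤ q N≤ ⟩
    q * weight (allFin size)   ≤⟨ chunks 1≤q (length T) ≤-refl lk (Uniqueₚ.allFin⁺ size) (λ {c} _ → all∈ c) ⟩
    a * (length T + q)         ≤⟨ *-monoʳ-≤ a (+-monoˡ-≤ q |T|≤1+2P) ⟩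
    a * (suc (2 * P) + q)      ∎
    where
    open ≤-Reasoning
    |T|≤1+2P : length T ≤ suc (2 * P)
    |T|≤1+2P = s≤s⁻¹ (begin
      suc (length T)      ≤⟨ |T|≤ ⟩
      2 * size            ≤⟨ *-monoʳ-≤ 2 size≤ ⟩
      2 * suc P           ≡⟨ *-suc 2 P ⟩
      suc (suc (2 * P))   ∎)

  wt≤ : 1 ≤ q → ∀ c → wt c ≤ a
  wt≤ 1≤q c = ≤-trans (m≤m+n (wt c) 0) (light {c ∷ []} {c ∷ []} [-] 1≤q ([] ∷ []) id)

  -- Each contracted vertex has weight at most `a`, so n ≤ s + N ≤ s (a + 1). A large graph thus
  -- cannot collapse to too few vertices for the charging argument.
  size-large : 1 ≤ q → ∀ {b} → b * suc a < n → b < size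
  size-large 1≤q {b} b<n = ≰⇒> λ s≤b → <⇒≱ b<n (begin
    n                               ≤⟨ n≤ ⟩
    size + N                        ≤⟨ +-monoʳ-≤ size N≤ ⟩
    size + weight (allFin size)     ≤⟨ +-monoʳ-≤ size (sum-bound wt (wt≤ 1≤q) (allFin size)) ⟩
    size + length (allFin size) * a ≡⟨ cong (λ l → size + l * a) (length-tabulate {n = size} id) ⟩
    size + size * a                 ≡⟨ *-suc size a ⟨
    size * suc a                    ≤⟨ *-monoˡ-≤ (suc a) s≤b ⟩
    b * suc a                       ∎)
    where open ≤-Reasoning

  wt-pair : ∀ {m u v} → Path Link m u v → suc m ≤ q → u ≢ v → wt u + wt v ≤ a
  wt-pair {u = u} {v} p m<q u≢v with path-linked p
  ... | L , lk , refl , v∈ = subst (_≤ a) (cong (_+_ (wt u)) (+-identityʳ (wt v)))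
    (light lk m<q ((u≢v ∷ []) ∷ [] ∷ []) λ { (here refl) → here refl ; (there (here refl)) → v∈ })

  Near : ℕ → Fin size → Fin size → Set
  Near r v t = ∃ λ m → m ≤ r × Path Link m v t

  -- wt v vertices charged to v. Vertices other than v are charged only when wt v ≥ 2, and then they are so close
  -- to v that no other vertex of weight ≥ 2 can charge them.
  record Tokens (r : ℕ) (v : Fin size) : Set where
    field
      tokens  : List (Fin size)
      unique  : Unique tokens
      number  : length tokens ≡ wt v
      charged : ∀ {t} → t ∈ tokens → t ≡ v ⊎ (wt t ≡ 0 × 2 ≤ wt v × Near r v t)
  open Tokens

  module _ {r} (a<4 : a < 4) (2r<q : suc (r + r) ≤ q) (tok : ∀ v → Tokens r v) where

    -- Two distinct vertices of weight ≥ 2 that both reach `t` would lie on a walk of at most 2r + 1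
    -- ≤ q vertices and carry weight at least 4 > a.
    heavy-apart : ∀ {v v′ t} → 2 ≤ wt v → 2 ≤ wt v′ → Near r v t → Near r v′ t → v ≡ v′
    heavy-apart {v} {v′} 2≤v 2≤v′ (i , i≤r , p) (j , j≤r , p′) with v Finₚ.≟ v′
    ... | yes v≡v′ = v≡v′
    ... | no v≢v′  = contradiction (+-mono-≤ 2≤v 2≤v′)
      (<⇒≱ (≤-<-trans (wt-pair (path-++ p (path-sym link-sym p′))
        (≤-trans (s≤s (+-mono-≤ i≤r j≤r)) 2r<q) v≢v′) a<4))

    no-tokens : ∀ {v t} → t ∈ tokens (tok v) → wt v ≢ 0
    no-tokens {v} t∈ wt≡0 with tokens (tok v) | number (tok v)
    no-tokens {v} (here _)  wt≡0 | _ ∷ _ | eq = case trans eq wt≡0 of λ ()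
    no-tokens {v} (there _) wt≡0 | _ ∷ _ | eq = case trans eq wt≡0 of λ ()

    -- A vertex claimed from outside has weight 0 and so does not claim itself. The only remaining
    -- conflict is between two heavy vertices, which `heavy-apart` excludes.
    tokens-disjoint : ∀ {v v′ t} → t ∈ tokens (tok v) → t ∈ tokens (tok v′) → v ≡ v′
    tokens-disjoint {v} {v′} t∈ t∈′ with charged (tok v) t∈ | charged (tok v′) t∈′
    ... | inj₁ refl             | inj₁ refl               = refl
    ... | inj₁ refl             | inj₂ (wt≡0 , _)         = contradiction wt≡0 (no-tokens t∈)
    ... | inj₂ (wt≡0 , _)       | inj₁ refl               = contradiction wt≡0 (no-tokens t∈′)
    ... | inj₂ (_ , 2≤v , near) | inj₂ (_ , 2≤v′ , near′) = heavy-apart 2≤v 2≤v′ near near′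

    private
      all-tokens = concatMap (tokens ∘ tok) (allFin size)

      all-tokens-unique : Unique all-tokens
      all-tokens-unique = concatMap-unique (Uniqueₚ.allFin⁺ size) (unique ∘ tok) tokens-disjoint

      N≤tokens : N ≤ length all-tokens
      N≤tokens = begin
        N                                                     ≤⟨ N≤ ⟩
        weight (allFin size)                                  ≡⟨ cong sum (map-cong (number ∘ tok) (allFin size)) ⟨
        sum (map (length ∘ tokens ∘ tok) (allFin size))       ≡⟨ length-concatMap (tokens ∘ tok) (allFin size) ⟨
        length all-tokens                                     ∎
        where open ≤-Reasoning

    tokens-bound : N ≤ suc P
    tokens-bound = ≤-trans N≤tokens (≤-trans (unique-length-Fin all-tokens-unique) size≤)

    tokens-bound-spare : ∀ x → (∀ v → x ∉ tokens (tok v)) → N ≤ P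
    tokens-bound-spare x spare = s≤s⁻¹ (≤-trans (s≤s N≤tokens)
      (≤-trans (unique-length-Fin (unique-∷ x∉ all-tokens-unique)) size≤))
      where
      x∉ : x ∉ all-tokens
      x∉ x∈ = let v , _ , x∈v = ∈-concatMap⁻′ (tokens ∘ tok) {allFin size} x∈ in spare v x∈v

-- Charging schemes for k = 3, 5, 6, 8

module _ {n N P a q} (X : Contraction n N P a q) where

  open Contraction X

  private
    Link = Linkᴾ links

  neighbour : 2 ≤ size → ∀ v → ∃ λ u → v ≢ u × Link v u
  neighbour 2≤s v with find-∉ X (v ∷ [])
  ... | inj₁ all∈ = contradiction (unique-⊆-length (Uniqueₚ.allFin⁺ size) (λ {c} _ → all∈ c))
    (<⇒≱ (≤-trans 2≤s (≤-reflexive (≡-sym (length-tabulate {n = size} id)))))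
  ... | inj₂ (_ , d∉) with exit X (v ∷ []) (here refl) d∉
  ... | _ , u , vu , here refl , u∉ = u , (λ { refl → u∉ (here refl) }) , vu

  third : 3 ≤ size → ∀ v u → ∃ λ y → v ≢ y × u ≢ y × (Link v y ⊎ Link u y)
  third 3≤s v u with find-∉ X (v ∷ u ∷ [])
  ... | inj₁ all∈ = contradiction (unique-⊆-length (Uniqueₚ.allFin⁺ size) (λ {c} _ → all∈ c))
    (<⇒≱ (≤-trans 3≤s (≤-reflexive (≡-sym (length-tabulate {n = size} id)))))
  ... | inj₂ (_ , d∉) with exit X (v ∷ u ∷ []) (here refl) d∉
  ... | _ , y , vy , here refl , y∉         =
    y , (λ { refl → y∉ (here refl) }) , (λ { refl → y∉ (there (here refl)) }) , inj₁ vy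
  ... | _ , y , uy , there (here refl) , y∉ =
    y , (λ { refl → y∉ (here refl) }) , (λ { refl → y∉ (there (here refl)) }) , inj₂ uy

  -- If `y` hangs on `v` instead of `u`, the walk is y, v, u; the covered vertices are the same.
  wt-triple : 3 ≤ q → ∀ {v u y} → v ≢ u → v ≢ y → u ≢ y → Link v u → Link v y ⊎ Link u y →
    wt v + (wt u + wt y) ≤ a
  wt-triple 3≤q {v} {u} {y} v≢u v≢y u≢y vu e =
    subst (λ m → wt v + (wt u + m) ≤ a) (+-identityʳ (wt y)) (sum≤ e)
    where
    vuy! : Unique (v ∷ u ∷ y ∷ [])
    vuy! = (v≢u ∷ v≢y ∷ []) ∷ (u≢y ∷ []) ∷ [] ∷ []
    sum≤ : Link v y ⊎ Link u y → wt v + (wt u + (wt y + 0)) ≤ a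
    sum≤ (inj₂ uy) = light (vu ∷ uy ∷ [-]) 3≤q vuy! id
    sum≤ (inj₁ vy) = light (Sum.swap vy ∷ vu ∷ [-]) 3≤q vuy! λ where
      (here refl)                 → there (here refl)
      (there (here refl))         → there (there (here refl))
      (there (there (here refl))) → here refl

  near-third : ∀ {v u y} → Link v u → Link v y ⊎ Link u y → Near X 2 v y
  near-third vu (inj₁ vy) = 1 , s≤s z≤n , vy ∷ []
  near-third vu (inj₂ uy) = 2 , ≤-refl , vu ∷ uy ∷ []

  light-tokens : ∀ {r v} → wt v ≤ 1 → Tokens X r v
  light-tokens {v = v} wt≤1 with wt v in eq
  ... | zero = record { tokens = [] ; unique = [] ; number = ≡-sym eq ; charged = λ () }
  ... | suc zero = record
    { tokens = v ∷ [] ; unique = [] ∷ [] ; number = ≡-sym eq ; charged = λ { (here refl) → inj₁ refl } }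
  ... | suc (suc _) = contradiction wt≤1 λ { (s≤s ()) }

  pair-tokens : ∀ {r v u} → v ≢ u → wt v ≡ 2 → wt u ≡ 0 → Near X r v u → Tokens X r v
  pair-tokens {v = v} {u} v≢u wtv wtu near = record
    { tokens  = v ∷ u ∷ []
    ; unique  = (v≢u ∷ []) ∷ [] ∷ []
    ; number  = ≡-sym wtv
    ; charged = λ where
        (here refl)         → inj₁ refl
        (there (here refl)) → inj₂ (wtu , ≤-reflexive (≡-sym wtv) , near)
    }

  -- A vertex of weight 2 exhausts the weight allowed on an edge, so its chosen neighbour has weight
  -- 0 and pays. The inclusion is kept for k = 6, where one must know that nothing else is claimed.
  radius-1-tokens : a ≤ 2 → 2 ≤ q → (nb : ∀ v → ∃ λ u → v ≢ u × Link v u) →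
    ∀ v → ∃ λ (τ : Tokens X 1 v) → Tokens.tokens τ ⊆ v ∷ proj₁ (nb v) ∷ []
  radius-1-tokens a≤2 2≤q nb v with ℕₚ.<-cmp (wt v) 2 | nb v
  ... | tri< wt<2 _ _ | _ = light-tokens (s≤s⁻¹ wt<2) , light-⊆ (light-tokens (s≤s⁻¹ wt<2))
    where
    light-⊆ : (τ : Tokens X 1 v) → Tokens.tokens τ ⊆ v ∷ _ ∷ []
    light-⊆ τ t∈ with Tokens.charged τ t∈
    ... | inj₁ refl          = here refl
    ... | inj₂ (_ , 2≤wt , _) = contradiction 2≤wt (<⇒≱ wt<2)
  ... | tri≈ _ wt≡2 _ | u , v≢u , vu =
    pair-tokens v≢u wt≡2 (n≤0⇒n≡0 (+-cancelˡ-≤ 2 _ _ 2+wtu≤2)) (1 , ≤-refl , vu ∷ []) , id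
    where
    2+wtu≤2 : 2 + wt u ≤ 2 + 0
    2+wtu≤2 = ≤-trans (≤-trans (≤-reflexive (cong (_+ wt u) (≡-sym wt≡2))) (wt-pair X (vu ∷ []) 2≤q v≢u)) a≤2
  ... | tri> _ _ 2<wt | _ = contradiction (≤-trans (wt≤ X (<⇒≤ 2≤q) v) a≤2) (<⇒≱ 2<wt)

  -- A vertex `v`, a neighbour `u` and a third vertex `y` attached to them weigh at most 3 together.
  -- If `v` weighs 2, then `u` or `y` weighs 0; if it weighs 3, both do.
  radius-2-tokens : a ≤ 3 → 3 ≤ q → 3 ≤ size → ∀ v → Tokens X 2 v
  radius-2-tokens a≤3 3≤q 3≤s v with neighbour (<⇒≤ 3≤s) v
  ... | u , v≢u , vu with third 3≤s v u
  ... | y , v≢y , u≢y , e = choose (wt v) refl (wt u) refl (≤-trans (wt-triple 3≤q v≢u v≢y u≢y vu e) a≤3)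
    where
    near-u : Near X 2 v u
    near-u = 1 , s≤s z≤n , vu ∷ []
    near-y : Near X 2 v y
    near-y = near-third vu e
    choose : ∀ i → wt v ≡ i → ∀ j → wt u ≡ j → wt v + (wt u + wt y) ≤ 3 → Tokens X 2 v
    choose 0 wtv _ wtu _ = light-tokens (≤-trans (≤-reflexive wtv) z≤n)
    choose 1 wtv _ wtu _ = light-tokens (≤-reflexive wtv)
    choose 2 wtv zero    wtu _  = pair-tokens v≢u wtv wtu near-u
    choose 2 wtv (suc j) wtu s≤ rewrite wtv | wtu =
      pair-tokens v≢y wtv (n≤0⇒n≡0 (m+n≤o⇒n≤o j (s≤s⁻¹ (s≤s⁻¹ (s≤s⁻¹ s≤))))) near-y
    choose 3 wtv j wtu s≤ = record
      { tokens  = v ∷ u ∷ y ∷ []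
      ; unique  = (v≢u ∷ v≢y ∷ []) ∷ (u≢y ∷ []) ∷ [] ∷ []
      ; number  = ≡-sym wtv
      ; charged = λ where
          (here refl)                 → inj₁ refl
          (there (here refl))         → inj₂ (m+n≡0⇒m≡0 (wt u) rest≡0 , 2≤wtv , near-u)
          (there (there (here refl))) → inj₂ (m+n≡0⇒n≡0 (wt u) rest≡0 , 2≤wtv , near-y)
      }
      where
      2≤wtv : 2 ≤ wt v
      2≤wtv = ≤-trans (n≤1+n 2) (≤-reflexive (≡-sym wtv))
      rest≡0 : wt u + wt y ≡ 0
      rest≡0 = n≤0⇒n≡0 (+-cancelˡ-≤ 3 _ 0 (≤-trans (≤-reflexive (cong (_+ (wt u + wt y)) (≡-sym wtv))) s≤))
    choose (suc (suc (suc (suc i)))) wtv j wtu s≤ =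
      contradiction (≤-trans (m≤m+n (wt v) _) s≤) (<⇒≱ (≤-trans (s≤s (s≤s (s≤s (s≤s z≤n)))) (≤-reflexive (≡-sym wtv))))

  zero-of-three : ∀ {v u y} → wt v + (wt u + wt y) ≤ 2 → ∃ λ z → wt z ≡ 0
  zero-of-three {v} {u} {y} s≤ with wt v in wtv | wt u in wtu | wt y in wty
  ... | zero  | _     | _     = v , wtv
  ... | suc _ | zero  | _     = u , wtu
  ... | suc _ | suc _ | zero  = y , wty
  ... | suc i | suc j | suc l = contradiction s≤ (<⇒≱ (begin
    3                       ≤⟨ m≤m+n 3 (i + (j + l)) ⟩
    3 + (i + (j + l))       ≡⟨ shuffle i j l ⟩
    suc i + (suc j + suc l) ∎))
    where
    open ≤-Reasoning
    shuffle : ∀ i j l → 3 + (i + (j + l)) ≡ suc i + (suc j + suc l)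
    shuffle = solve-∀

-- All weights are at most 1 and two neighbours weigh at most 1 together. Hence some vertex has
-- weight 0, and with no heavy vertices nobody claims it.
bound-1-2 : ∀ {n N P} → Contraction n N P 1 2 → 2 < n → N ≤ P
bound-1-2 {n} {N} {P} X 2<n with neighbour X (size-large X (s≤s z≤n) {1} 2<n) (Contraction.nonempty X)
... | u , v≢u , vu = spare (zero-of-two (wt-pair X (vu ∷ []) ≤-refl v≢u))
  where
  open Contraction X
  tok : ∀ v → Tokens X 0 v
  tok v = light-tokens X (wt≤ X (s≤s z≤n) v)
  zero-of-two : ∀ {v u} → wt v + wt u ≤ 1 → ∃ λ z → wt z ≡ 0
  zero-of-two {v} {u} s≤ with wt v in wtv | wt u in wtu
  ... | zero  | _     = v , wtv
  ... | suc _ | zero  = u , wtu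
  ... | suc i | suc j = contradiction (≤-trans (s≤s (≤-trans (s≤s z≤n) (m≤n+m (suc j) i))) s≤) λ { (s≤s ()) }
  spare : ∃ (λ z → wt z ≡ 0) → N ≤ P
  spare (z , wtz) = tokens-bound-spare X (s≤s (s≤s z≤n)) (s≤s z≤n) tok z λ v z∈ → case Tokens.charged (tok v) z∈ of λ where
    (inj₁ refl)           → no-tokens X (s≤s (s≤s z≤n)) (s≤s z≤n) tok z∈ wtz
    (inj₂ (_ , 2≤wt , _)) → <⇒≱ 2≤wt (wt≤ X (s≤s z≤n) v)

bound-2-3 : ∀ {n N P} → Contraction n N P 2 3 → 3 < n → N ≤ suc P
bound-2-3 X 3<n = tokens-bound X (n≤1+n 3) ≤-refl
  (λ v → proj₁ (radius-1-tokens X ≤-refl (n≤1+n 2) (neighbour X (size-large X (s≤s z≤n) {1} 3<n)) v))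

-- Without heavy vertices, one of three connected vertices has weight 0 and stays unclaimed. With a
-- heavy `v`, its neighbour `u` pays, and a third vertex `y` within distance 2 of `v` is left over.
bound-2-4 : ∀ {n N P} → Contraction n N P 2 4 → 6 < n → N ≤ P
bound-2-4 {n} {N} {P} X 6<n with Finₚ.any? (λ v → 2 ≤? Contraction.wt X v)
... | no none = spare (zero-of-three X (wt-triple X (n≤1+n 3) v≢u v≢y u≢y vu e))
  where
  open Contraction X
  3≤s : 3 ≤ size
  3≤s = size-large X (s≤s z≤n) {2} 6<n
  tok : ∀ v → Tokens X 0 v
  tok v = light-tokens X (≮⇒≥ λ 2≤wt → none (v , 2≤wt))
  vertex = neighbour X (<⇒≤ 3≤s) nonempty
  u = proj₁ vertex
  v≢u = proj₁ (proj₂ vertex)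
  vu  = proj₂ (proj₂ vertex)
  vertex′ = third X 3≤s nonempty u
  y = proj₁ vertex′
  v≢y = proj₁ (proj₂ vertex′)
  u≢y = proj₁ (proj₂ (proj₂ vertex′))
  e   = proj₂ (proj₂ (proj₂ vertex′))
  spare : ∃ (λ z → wt z ≡ 0) → N ≤ P
  spare (z , wtz) = tokens-bound-spare X (n≤1+n 3) (s≤s z≤n) tok z λ v z∈ → case Tokens.charged (tok v) z∈ of λ where
    (inj₁ refl)           → no-tokens X (n≤1+n 3) (s≤s z≤n) tok z∈ wtz
    (inj₂ (_ , 2≤wt , _)) → none (v , 2≤wt)
... | yes (v , 2≤wtv) = spare
  where
  open Contraction X
  3≤s : 3 ≤ size
  3≤s = size-large X (s≤s z≤n) {2} 6<n
  nb = neighbour X (<⇒≤ 3≤s)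
  T = radius-1-tokens X ≤-refl (s≤s (s≤s z≤n)) nb
  tok : ∀ v → Tokens X 1 v
  tok v = proj₁ (T v)
  u = proj₁ (nb v)
  vu  = proj₂ (proj₂ (nb v))
  vertex′ = third X 3≤s v u
  y = proj₁ vertex′
  v≢y = proj₁ (proj₂ vertex′)
  u≢y = proj₁ (proj₂ (proj₂ vertex′))
  near : Near X 2 v y
  near = near-third X vu (proj₂ (proj₂ (proj₂ vertex′)))
  m = proj₁ near
  m≤2 = proj₁ (proj₂ near)
  p = proj₂ (proj₂ near)
  wty : wt y ≡ 0
  wty = n≤0⇒n≡0 (+-cancelˡ-≤ 2 _ 0 (≤-trans (+-monoˡ-≤ (wt y) 2≤wtv)
    (wt-pair X p (≤-trans (s≤s m≤2) (n≤1+n 3)) v≢y)))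
  -- Another heavy vertex next to `y` would be at most 1 + 2 steps from `v`. That walk has at most 4
  -- = q vertices but weight at least 4 > 2.
  own : ∀ {v′ j} → 2 ≤ wt v′ → j ≤ 1 → Path (Linkᴾ links) j v′ y → v′ ≡ v
  own {v′} 2≤wt′ j≤1 p′ with v′ Finₚ.≟ v
  ... | yes v′≡v = v′≡v
  ... | no v′≢v  = contradiction
    (≤-trans (+-mono-≤ 2≤wt′ 2≤wtv)
      (wt-pair X (path-++ p′ (path-sym Sum.swap p)) (s≤s (+-mono-≤ j≤1 m≤2)) v′≢v))
    λ { (s≤s (s≤s ())) }
  spare : N ≤ P
  spare = tokens-bound-spare X (n≤1+n 3) (n≤1+n 3) tok y λ v′ y∈ → case Tokens.charged (tok v′) y∈ of λ where
    (inj₁ refl)                       → no-tokens X (n≤1+n 3) (n≤1+n 3) tok y∈ wty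
    (inj₂ (_ , 2≤wt′ , _ , j≤1 , p′)) → case own 2≤wt′ j≤1 p′ of λ where
      refl → case proj₂ (T v) y∈ of λ where
        (here y≡v)         → v≢y (≡-sym y≡v)
        (there (here y≡u)) → u≢y (≡-sym y≡u)

bound-3-5 : ∀ {n N P} → Contraction n N P 3 5 → 8 < n → N ≤ suc P
bound-3-5 X 8<n = tokens-bound X ≤-refl ≤-refl
  (radius-2-tokens X ≤-refl (s≤s (s≤s (s≤s z≤n))) (size-large X (s≤s z≤n) {2} 8<n))

diff-≤ : ∀ c d {N P} → d + N ≤ P + c → + d ℤ.- + c ℤ.≤ + P ℤ.- + N
diff-≤ c d {N} {P} le = ℤₚ.0≤i-j⇒j≤i (subst (ℤ._≤_ (+ 0)) (swap (+ P) (+ c) (+ d) (+ N)) (ℤₚ.i≤j⇒0≤j-i (ℤ.+≤+ le)))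
  where
  swap : ∀ p c d m → (p ℤ.+ c) ℤ.- (d ℤ.+ m) ≡ (p ℤ.- m) ℤ.- (d ℤ.- c)
  swap = ℤS.solve-∀

-- Forcing values and constant lower bounds

module _ (G : Graph) where

  #edges : ℕ
  #edges = length (edges (adj G))

  #neg #pos : Weighing G → ℕ
  #neg w = length (neg w (edges (adj G)))
  #pos w = length (pos w (edges (adj G)))

  wG≡ : ∀ w → wG G w ≡ + #pos w ℤ.- + #neg w
  wG≡ w = weightOn-edges G w (adj G)

  wG-≥ : ∀ c d {w} → d + #neg w ≤ #pos w + c → + d ℤ.- + c ℤ.≤ wG G w
  wG-≥ c d {w} le = subst (ℤ._≤_ (+ d ℤ.- + c)) (≡-sym (wG≡ w)) (diff-≤ c d le)

  wG-positive : ∀ {w} → #neg w < #pos w → + 0 ℤ.< wG G w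
  wG-positive lt = ℤₚ.<-≤-trans (ℤ.+<+ (s≤s z≤n)) (wG-≥ 0 1 (≤-trans lt (m≤m+n _ 0)))

  #neg+#pos : ∀ w → #edges ≡ #neg w + #pos w
  #neg+#pos w = length-neg-pos w (edges (adj G))

  #edges-≥ : IsConnected G → n G ≤ suc #edges
  #edges-≥ (_ , walks) = ≤-trans (Components.size-bound K)
    (+-monoˡ-≤ #edges (components-connected K λ u v → walk⇒reach (walks u v)))
    where K = components (edges (adj G))

  contract : ∀ {k w} a q → IsConnected G → LocalPositive G k w → suc k ≤ n G →
    k ≤ suc a + suc a → a + q ≤ k → Contraction (n G) (#neg w) (#pos w) a q
  contract {w = w} a q conn lp k<n = contraction G w conn lp (s≤s⁻¹ (≤-trans k<n (#edges-≥ conn)))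

module _ {𝒢 : Family} (conn : ∀ G → 𝒢 G → IsConnected G) where

  forcing-from : ∀ k N₀ → (∀ G → 𝒢 G → N₀ ≤ n G → ∀ w → LocalPositive G k w → #neg G w < #pos G w) → Forcing 𝒢 k
  forcing-from k N₀ h = N₀ , λ G G∈ N₀≤n w lp → wG-positive G (h G G∈ N₀≤n w lp)

  -- For a = 0 the tour bound leaves no negative edge at all, and a large connected graph has at
  -- least one edge.
  forcing-a≡0 : ∀ k q → 1 ≤ q → q ≤ k → k ≤ 2 → 1 ≤ k → Forcing 𝒢 k
  forcing-a≡0 k (suc q) 1≤q q≤k k≤2 1≤k = forcing-from k (suc k) λ G G∈ k<n w lp →
    let X  = contract G 0 (suc q) (conn G G∈) lp k<n k≤2 q≤k
        N≡0 = m+n≡0⇒m≡0 (#neg G w) (n≤0⇒n≡0 (tour-bound X 1≤q))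
        E≥1 = s≤s⁻¹ (≤-trans (≤-trans (s≤s 1≤k) k<n) (#edges-≥ G (conn G G∈)))
    in subst (_< #pos G w) (≡-sym N≡0)
         (subst (1 ≤_) (trans (#neg+#pos G w) (cong (_+ #pos G w) N≡0)) E≥1)

  -- Here the tour bound reads 3 N ≤ 2 P + 4. Hence P ≤ N would give N ≤ 4 and at most 9 vertices.
  forcing-4 : Forcing 𝒢 4
  forcing-4 = forcing-from 4 10 λ G G∈ 10≤n w lp →
    let X  = contract G 1 3 (conn G G∈) lp (≤-trans (m≤m+n 5 5) 10≤n) ≤-refl ≤-refl
        N = #neg G w
        P = #pos G w
    in ≰⇒> λ P≤N →
      let N≤4 : N ≤ 4
          N≤4 = +-cancelˡ-≤ (N + N) N 4 (begin
            N + N + N           ≡⟨ triple N ⟩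
            3 * N               ≤⟨ tour-bound X (s≤s z≤n) ⟩
            1 * (suc (2 * P) + 3) ≡⟨ double P ⟩
            P + P + 4           ≤⟨ +-monoˡ-≤ 4 (+-mono-≤ P≤N P≤N) ⟩
            N + N + 4           ∎)
      in contradiction (begin
           10                ≤⟨ 10≤n ⟩
           n G               ≤⟨ #edges-≥ G (conn G G∈) ⟩
           suc (#edges G)    ≡⟨ cong suc (#neg+#pos G w) ⟩
           suc (N + P)       ≤⟨ s≤s (+-mono-≤ N≤4 (≤-trans P≤N N≤4)) ⟩
           9                 ∎) (<⇒≱ ≤-refl)
    where
    open ≤-Reasoning
    triple : ∀ x → x + x + x ≡ 3 * x
    triple = solve-∀
    double : ∀ x → 1 * (suc (2 * x) + 3) ≡ x + x + 4
    double = solve-∀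

  -- Ten vertices suffice for every use: n > k holds for k ≤ 8, and the charging arguments ask at
  -- most for n > 8.
  bound-from : ∀ k c → (∀ G → 𝒢 G → 10 ≤ n G → ∀ w → LocalPositive G k w → #neg G w ≤ c + #pos G w) →
    Bound 𝒢 k (+ 0 ℤ.- + c)
  bound-from k c h = 10 , λ G G∈ 10≤n w lp →
    wG-≥ G c 0 (≤-trans (h G G∈ 10≤n w lp) (≤-reflexive (+-comm c _)))

  bound-3 : Bound 𝒢 3 (+ 0)
  bound-3 = bound-from 3 0 λ G G∈ 10≤n w lp → bound-1-2
    (contract G 1 2 (conn G G∈) lp (≤-trans (m≤m+n 4 6) 10≤n) (n≤1+n 3) ≤-refl) (≤-trans (m≤m+n 3 7) 10≤n)

  bound-5 : Bound 𝒢 5 -[1+ 0 ]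
  bound-5 = bound-from 5 1 λ G G∈ 10≤n w lp → bound-2-3
    (contract G 2 3 (conn G G∈) lp (≤-trans (m≤m+n 6 4) 10≤n) (n≤1+n 5) ≤-refl) (≤-trans (m≤m+n 4 6) 10≤n)

  bound-6 : Bound 𝒢 6 (+ 0)
  bound-6 = bound-from 6 0 λ G G∈ 10≤n w lp → bound-2-4
    (contract G 2 4 (conn G G∈) lp (≤-trans (m≤m+n 7 3) 10≤n) ≤-refl ≤-refl) (≤-trans (m≤m+n 7 3) 10≤n)

  bound-8 : Bound 𝒢 8 -[1+ 0 ]
  bound-8 = bound-from 8 1 λ G G∈ 10≤n w lp → bound-3-5
    (contract G 3 5 (conn G G∈) lp (≤-trans (m≤m+n 9 1) 10≤n) ≤-refl ≤-refl) (≤-trans (m≤m+n 9 1) 10≤n)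

-- Rational bounds

ℤtoℚ-+ : ∀ i j → ℤtoℚ (i ℤ.+ j) ≡ ℤtoℚ i ℚ.+ ℤtoℚ j
ℤtoℚ-+ i j = ℚₚ.toℚᵘ-injective (begin
  ℚ.toℚᵘ (ℤtoℚ (i ℤ.+ j))                  ≈⟨ ℚₚ.toℚᵘ-fromℚᵘ (ℚᵘ.mkℚᵘ (i ℤ.+ j) 0) ⟩
  ℚᵘ.mkℚᵘ (i ℤ.+ j) 0                      ≈⟨ ℚᵘ.*≡* (arith i j) ⟩
  ℚᵘ.mkℚᵘ i 0 ℚᵘ.+ ℚᵘ.mkℚᵘ j 0             ≈⟨ ℚᵘₚ.+-cong (ℚₚ.toℚᵘ-fromℚᵘ (ℚᵘ.mkℚᵘ i 0)) (ℚₚ.toℚᵘ-fromℚᵘ (ℚᵘ.mkℚᵘ j 0)) ⟨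
  ℚ.toℚᵘ (ℤtoℚ i) ℚᵘ.+ ℚ.toℚᵘ (ℤtoℚ j)    ≈⟨ ℚₚ.toℚᵘ-homo-+ (ℤtoℚ i) (ℤtoℚ j) ⟨
  ℚ.toℚᵘ (ℤtoℚ i ℚ.+ ℤtoℚ j)              ∎)
  where
  open ℚᵘₚ.≃-Reasoning
  arith : ∀ i j → (i ℤ.+ j) ℤ.* + 1 ≡ (i ℤ.* + 1 ℤ.+ j ℤ.* + 1) ℤ.* + 1
  arith = ℤS.solve-∀

ℤtoℚ-* : ∀ i j → ℤtoℚ (i ℤ.* j) ≡ ℤtoℚ i ℚ.* ℤtoℚ j
ℤtoℚ-* i j = ℚₚ.toℚᵘ-injective (begin
  ℚ.toℚᵘ (ℤtoℚ (i ℤ.* j))                  ≈⟨ ℚₚ.toℚᵘ-fromℚᵘ (ℚᵘ.mkℚᵘ (i ℤ.* j) 0) ⟩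
  ℚᵘ.mkℚᵘ i 0 ℚᵘ.* ℚᵘ.mkℚᵘ j 0             ≈⟨ ℚᵘₚ.*-cong (ℚₚ.toℚᵘ-fromℚᵘ (ℚᵘ.mkℚᵘ i 0)) (ℚₚ.toℚᵘ-fromℚᵘ (ℚᵘ.mkℚᵘ j 0)) ⟨
  ℚ.toℚᵘ (ℤtoℚ i) ℚᵘ.* ℚ.toℚᵘ (ℤtoℚ j)    ≈⟨ ℚₚ.toℚᵘ-homo-* (ℤtoℚ i) (ℤtoℚ j) ⟨
  ℚ.toℚᵘ (ℤtoℚ i ℚ.* ℤtoℚ j)              ∎)
  where open ℚᵘₚ.≃-Reasoning

ℤtoℚ-≤ : ∀ {i j} → i ℤ.≤ j → ℤtoℚ i ℚ.≤ ℤtoℚ j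
ℤtoℚ-≤ {i} {j} i≤j = ℚₚ.toℚᵘ-cancel-≤ (begin
  ℚ.toℚᵘ (ℤtoℚ i) ≃⟨ ℚₚ.toℚᵘ-fromℚᵘ (ℚᵘ.mkℚᵘ i 0) ⟩
  ℚᵘ.mkℚᵘ i 0     ≤⟨ ℚᵘ.*≤* (ℤₚ.*-monoʳ-≤-nonNeg (+ 1) i≤j) ⟩
  ℚᵘ.mkℚᵘ j 0     ≃⟨ ℚₚ.toℚᵘ-fromℚᵘ (ℚᵘ.mkℚᵘ j 0) ⟨
  ℚ.toℚᵘ (ℤtoℚ j) ∎)
  where open ℚᵘₚ.≤-Reasoning

frac-* : ∀ u d → frac u (suc d) ℚ.* ℕtoℚ (suc d) ≡ ℤtoℚ u
frac-* u d = ℚₚ.toℚᵘ-injective (begin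
  ℚ.toℚᵘ (frac u (suc d) ℚ.* ℕtoℚ (suc d))             ≈⟨ ℚₚ.toℚᵘ-homo-* (frac u (suc d)) (ℕtoℚ (suc d)) ⟩
  ℚ.toℚᵘ (frac u (suc d)) ℚᵘ.* ℚ.toℚᵘ (ℕtoℚ (suc d))  ≈⟨ ℚᵘₚ.*-cong (ℚₚ.toℚᵘ-fromℚᵘ (ℚᵘ.mkℚᵘ u d)) (ℚₚ.toℚᵘ-fromℚᵘ (ℚᵘ.mkℚᵘ (+ suc d) 0)) ⟩
  ℚᵘ.mkℚᵘ u d ℚᵘ.* ℚᵘ.mkℚᵘ (+ suc d) 0                 ≈⟨ ℚᵘ.*≡* (trans (arith u (+ suc d)) (cong (λ e → u ℤ.* + e) (≡-sym (*-identityʳ (suc d))))) ⟩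
  ℚᵘ.mkℚᵘ u 0                                           ≈⟨ ℚₚ.toℚᵘ-fromℚᵘ (ℚᵘ.mkℚᵘ u 0) ⟨
  ℚ.toℚᵘ (ℤtoℚ u)                                      ∎)
  where
  open ℚᵘₚ.≃-Reasoning
  arith : ∀ u d → (u ℤ.* d) ℤ.* + 1 ≡ u ℤ.* d
  arith = ℤS.solve-∀

ℕtoℚ-pos : ∀ d → ℚ.Positive (ℕtoℚ (suc d))
ℕtoℚ-pos d = ℚₚ.normalize-pos (suc d) 1

0≤ℕtoℚ : ∀ k → 0ℚ ℚ.≤ ℕtoℚ k
0≤ℕtoℚ k = ℤtoℚ-≤ {+ 0} {+ k} (ℤ.+≤+ z≤n)

-- A positive rational is at least 1 / d for its denominator d.
little-o-const : ∀ K → LittleO (λ _ → ℕtoℚ K)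
little-o-const K (ℚ.mkℚ (+ suc p) d-1 cop) 0<ε = K * suc d-1 , λ m Kd≤m → begin
  ℚ.∣ ℕtoℚ K ∣               ≡⟨ ℚₚ.0≤p⇒∣p∣≡p (0≤ℕtoℚ K) ⟩
  ℕtoℚ K                     ≤⟨ ℤtoℚ-≤ (ℤ.+≤+ (m≤n*m K (suc p))) ⟩
  ℕtoℚ (suc p * K)           ≡⟨ trans (cong ℤtoℚ (ℤₚ.pos-* (suc p) K)) (ℤtoℚ-* (+ suc p) (+ K)) ⟩
  ℕtoℚ (suc p) ℚ.* ℕtoℚ K   ≡⟨ cong (ℚ._* ℕtoℚ K) (frac-* (+ suc p) d-1) ⟨
  (frac (+ suc p) (suc d-1) ℚ.* ℕtoℚ (suc d-1)) ℚ.* ℕtoℚ K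
                             ≡⟨ cong (λ e → (e ℚ.* ℕtoℚ (suc d-1)) ℚ.* ℕtoℚ K) (ℚₚ.↥p/↧p≡p ε) ⟩
  (ε ℚ.* ℕtoℚ (suc d-1)) ℚ.* ℕtoℚ K
                             ≡⟨ ℚₚ.*-assoc ε (ℕtoℚ (suc d-1)) (ℕtoℚ K) ⟩
  ε ℚ.* (ℕtoℚ (suc d-1) ℚ.* ℕtoℚ K)
                             ≡⟨ cong (ℚ._*_ ε) (trans (cong ℤtoℚ (ℤₚ.pos-* (suc d-1) K)) (ℤtoℚ-* (+ suc d-1) (+ K))) ⟨
  ε ℚ.* ℕtoℚ (suc d-1 * K)  ≤⟨ ℚₚ.*-monoˡ-≤-nonNeg ε (ℤtoℚ-≤ (ℤ.+≤+ (≤-trans (≤-reflexive (*-comm (suc d-1) K)) Kd≤m))) ⟩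
  ε ℚ.* ℕtoℚ m              ∎
  where
  open ℚₚ.≤-Reasoning
  ε = ℚ.mkℚ (+ suc p) d-1 cop
little-o-const K (ℚ.mkℚ (+ zero) d-1 cop) (ℚ.*<* (ℤ.+<+ ()))
little-o-const K (ℚ.mkℚ -[1+ p ] d-1 cop) (ℚ.*<* ())

ℤtoℚ-neg : ∀ i → ℤtoℚ (ℤ.- i) ≡ ℚ.- ℤtoℚ i
ℤtoℚ-neg i = begin
  ℤtoℚ (ℤ.- i)                  ≡⟨ cong ℤtoℚ (ℤₚ.-1*i≡-i i) ⟨
  ℤtoℚ (ℤ.-1ℤ ℤ.* i)            ≡⟨ ℤtoℚ-* ℤ.-1ℤ i ⟩
  (ℚ.- ℚ.1ℚ) ℚ.* ℤtoℚ i         ≡⟨ ℚₚ.neg-distribˡ-* ℚ.1ℚ (ℤtoℚ i) ⟨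
  ℚ.- (ℚ.1ℚ ℚ.* ℤtoℚ i)         ≡⟨ cong ℚ.-_ (ℚₚ.*-identityˡ (ℤtoℚ i)) ⟩
  ℚ.- ℤtoℚ i                     ∎
  where open ≡-Reasoning

ℤtoℚ-- : ∀ i j → ℤtoℚ (i ℤ.- j) ≡ ℤtoℚ i ℚ.- ℤtoℚ j
ℤtoℚ-- i j = trans (ℤtoℚ-+ i (ℤ.- j)) (cong (ℚ._+_ (ℤtoℚ i)) (ℤtoℚ-neg j))

-frac-* : ∀ u d → (ℚ.- frac u (suc d)) ℚ.* ℕtoℚ (suc d) ≡ ℤtoℚ (ℤ.- u)
-frac-* u d = trans (≡-sym (ℚₚ.neg-distribˡ-* (frac u (suc d)) (ℕtoℚ (suc d))))
  (trans (cong ℚ.-_ (frac-* u d)) (≡-sym (ℤtoℚ-neg u)))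

scale-diff : ∀ c e k d → (c ℚ.* e ℚ.- k) ℚ.* d ≡ (c ℚ.* d) ℚ.* e ℚ.- k ℚ.* d
scale-diff = solve 4 (λ c e k d → (c :* e :- k) :* d := (c :* d) :* e :- k :* d) refl
  where open +-*-Solver

p≤∣p∣ : ∀ p → p ℚ.≤ ℚ.∣ p ∣
p≤∣p∣ p with ℚₚ.∣p∣≡p∨∣p∣≡-p p
... | inj₁ eq = ℚₚ.≤-reflexive (≡-sym eq)
... | inj₂ eq = ℚₚ.≤-trans
  (subst (ℚ._≤ 0ℚ) (neg-involutive p) (ℚₚ.neg-antimono-≤ (subst (0ℚ ℚ.≤_) eq (ℚₚ.0≤∣p∣ p)))) (ℚₚ.0≤∣p∣ p)
  where
  open +-*-Solver
  neg-involutive : ∀ p → ℚ.- (ℚ.- p) ≡ p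
  neg-involutive = solve 1 (λ p → :- (:- p) := p) refl

numEdges≡ : ∀ G → numEdges G ≡ + #edges G
numEdges≡ G = edgeCount-edges (adj G)

module _ (u d : ℕ) where

  private
    c : ℚ.ℚ
    c = ℚ.- frac (+ u) (suc d)

    D : ℚ.ℚ
    D = ℕtoℚ (suc d)

    instance
      D-positive : ℚ.Positive D
      D-positive = ℕtoℚ-pos d

  ratio-≤ : ∀ {G w} K → suc d * #neg G w ≤ suc d * #pos G w + u * #edges G + K →
    c ℚ.* ℤtoℚ (numEdges G) ℚ.- ℕtoℚ K ℚ.≤ ℤtoℚ (wG G w)
  ratio-≤ {G} {w} K le = ℚₚ.*-cancelʳ-≤-pos D (begin
    (c ℚ.* ℤtoℚ (numEdges G) ℚ.- ℕtoℚ K) ℚ.* D       ≡⟨ cong (λ e → (c ℚ.* ℤtoℚ e ℚ.- ℕtoℚ K) ℚ.* D) (numEdges≡ G) ⟩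
    (c ℚ.* ℕtoℚ E ℚ.- ℕtoℚ K) ℚ.* D                  ≡⟨ scale-diff c (ℕtoℚ E) (ℕtoℚ K) D ⟩
    (c ℚ.* D) ℚ.* ℕtoℚ E ℚ.- ℕtoℚ K ℚ.* D            ≡⟨ cong₂ (λ x y → x ℚ.* ℕtoℚ E ℚ.- y) (-frac-* (+ u) d) (≡-sym (ℤtoℚ-* (+ K) (+ suc d))) ⟩
    ℤtoℚ (ℤ.- + u) ℚ.* ℕtoℚ E ℚ.- ℤtoℚ (+ K ℤ.* + suc d) ≡⟨ cong (ℚ._- ℤtoℚ (+ K ℤ.* + suc d)) (ℤtoℚ-* (ℤ.- + u) (+ E)) ⟨
    ℤtoℚ (ℤ.- + u ℤ.* + E) ℚ.- ℤtoℚ (+ K ℤ.* + suc d) ≡⟨ ℤtoℚ-- (ℤ.- + u ℤ.* + E) (+ K ℤ.* + suc d) ⟨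
    ℤtoℚ (ℤ.- + u ℤ.* + E ℤ.- + K ℤ.* + suc d)        ≤⟨ ℤtoℚ-≤ bound ⟩
    ℤtoℚ ((+ P ℤ.- + N) ℤ.* + suc d)                    ≡⟨ cong (λ v → ℤtoℚ (v ℤ.* + suc d)) (wG≡ G w) ⟨
    ℤtoℚ (wG G w ℤ.* + suc d)                           ≡⟨ ℤtoℚ-* (wG G w) (+ suc d) ⟩
    ℤtoℚ (wG G w) ℚ.* D                                 ∎)
    where
    open ℚₚ.≤-Reasoning
    E = #edges G
    N = #neg G w
    P = #pos G w
    -- The error is enlarged to a multiple of the denominator, so that division leaves exactly `K`.
    le′ : suc d * N ≤ suc d * P + u * E + K * suc d
    le′ = ≤-trans le (+-monoʳ-≤ _ (m≤m*n K (suc d)))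
    arith : ∀ d p u e k m → (d ℤ.* p ℤ.+ u ℤ.* e ℤ.+ k ℤ.* d) ℤ.- d ℤ.* m ≡
      (p ℤ.- m) ℤ.* d ℤ.- (ℤ.- u ℤ.* e ℤ.- k ℤ.* d)
    arith = ℤS.solve-∀
    rearrange : + (suc d * P + u * E + K * suc d) ℤ.- + (suc d * N) ≡
      (+ P ℤ.- + N) ℤ.* + suc d ℤ.- (ℤ.- + u ℤ.* + E ℤ.- + K ℤ.* + suc d)
    rearrange = trans
      (cong₂ ℤ._-_
        (cong₂ ℤ._+_ (cong₂ ℤ._+_ (ℤₚ.pos-* (suc d) P) (ℤₚ.pos-* u E)) (ℤₚ.pos-* K (suc d)))
        (ℤₚ.pos-* (suc d) N))
      (arith (+ suc d) (+ P) (+ u) (+ E) (+ K) (+ N))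
    bound : ℤ.- + u ℤ.* + E ℤ.- + K ℤ.* + suc d ℤ.≤ (+ P ℤ.- + N) ℤ.* + suc d
    bound = ℤₚ.0≤i-j⇒j≤i (subst (ℤ._≤_ (+ 0)) rearrange (ℤₚ.i≤j⇒0≤j-i (ℤ.+≤+ le′)))

  ratio-≥ : ∀ {G w} → suc d * #pos G w + u * #edges G ≤ suc d * #neg G w →
    ℤtoℚ (wG G w) ℚ.≤ c ℚ.* ℤtoℚ (numEdges G)
  ratio-≥ {G} {w} le = ℚₚ.*-cancelʳ-≤-pos D (begin
    ℤtoℚ (wG G w) ℚ.* D                 ≡⟨ ℤtoℚ-* (wG G w) (+ suc d) ⟨
    ℤtoℚ (wG G w ℤ.* + suc d)           ≡⟨ cong (λ v → ℤtoℚ (v ℤ.* + suc d)) (wG≡ G w) ⟩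
    ℤtoℚ ((+ P ℤ.- + N) ℤ.* + suc d)    ≤⟨ ℤtoℚ-≤ bound ⟩
    ℤtoℚ (ℤ.- + u ℤ.* + E)              ≡⟨ ℤtoℚ-* (ℤ.- + u) (+ E) ⟩
    ℤtoℚ (ℤ.- + u) ℚ.* ℕtoℚ E          ≡⟨ cong (ℚ._* ℕtoℚ E) (-frac-* (+ u) d) ⟨
    (c ℚ.* D) ℚ.* ℕtoℚ E               ≡⟨ swap c D (ℕtoℚ E) ⟩
    (c ℚ.* ℕtoℚ E) ℚ.* D               ≡⟨ cong (λ e → (c ℚ.* ℤtoℚ e) ℚ.* D) (numEdges≡ G) ⟨
    (c ℚ.* ℤtoℚ (numEdges G)) ℚ.* D    ∎)
    where
    open ℚₚ.≤-Reasoning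
    E = #edges G
    N = #neg G w
    P = #pos G w
    swap : ∀ x y z → (x ℚ.* y) ℚ.* z ≡ (x ℚ.* z) ℚ.* y
    swap = solve 3 (λ x y z → (x :* y) :* z := (x :* z) :* y) refl
      where open +-*-Solver
    arith : ∀ d p u e m → d ℤ.* m ℤ.- (d ℤ.* p ℤ.+ u ℤ.* e) ≡ ℤ.- u ℤ.* e ℤ.- (p ℤ.- m) ℤ.* d
    arith = ℤS.solve-∀
    rearrange : + (suc d * N) ℤ.- + (suc d * P + u * E) ≡ ℤ.- + u ℤ.* + E ℤ.- (+ P ℤ.- + N) ℤ.* + suc d
    rearrange = trans
      (cong₂ ℤ._-_ (ℤₚ.pos-* (suc d) N) (cong₂ ℤ._+_ (ℤₚ.pos-* (suc d) P) (ℤₚ.pos-* u E)))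
      (arith (+ suc d) (+ P) (+ u) (+ E) (+ N))
    bound : (+ P ℤ.- + N) ℤ.* + suc d ℤ.≤ ℤ.- + u ℤ.* + E
    bound = ℤₚ.0≤i-j⇒j≤i (subst (ℤ._≤_ (+ 0)) rearrange (ℤₚ.i≤j⇒0≤j-i (ℤ.+≤+ le)))

  ratio-≤0 : c ℚ.≤ 0ℚ
  ratio-≤0 = ℚₚ.*-cancelʳ-≤-pos D (begin
    c ℚ.* D        ≡⟨ -frac-* (+ u) d ⟩
    ℤtoℚ (ℤ.- + u) ≤⟨ ℤtoℚ-≤ (ℤₚ.neg-mono-≤ (ℤ.+≤+ (z≤n {u}))) ⟩
    0ℚ             ≡⟨ ℚₚ.*-zeroˡ D ⟨
    0ℚ ℚ.* D       ∎)
    where open ℚₚ.≤-Reasoning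

  -- The ratio itself is admissible with a constant error term, so it is a witness for every smaller
  -- `c′`.
  at-least : ∀ {𝒢 k} K →
    (∀ G → 𝒢 G → ∀ w → LocalPositive G k w → suc d * #neg G w ≤ suc d * #pos G w + u * #edges G + K) →
    cAtLeast 𝒢 k (ℚ.- frac (+ u) (suc d))
  at-least K h c′ c′<c = c , ℚₚ.<⇒≤ c′<c , ratio-≤0 , (λ _ → ℕtoℚ K) , little-o-const K ,
    λ G G∈ w lp → ratio-≤ {G} {w} K (h G G∈ w lp)

  -- If c < r < c′, the error on large graphs is at most (r - c) |E|. Then c′ |E| ≤ w(G) + (r - c)
  -- |E| ≤ r |E| on an example, which is impossible.
  at-most : ∀ {𝒢 : Family} {k} → (∀ M → ∃ λ G → 𝒢 G × Σ (Weighing G) λ w → LocalPositive G k w × M ≤ #edges G ×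
      suc d * #pos G w + u * #edges G ≤ suc d * #neg G w) →
    cAtMost 𝒢 k (ℚ.- frac (+ u) (suc d))
  at-most h c′ (_ , g , g-small , adm) with c′ ℚ.≤? c
  ... | yes c′≤c = c′≤c
  ... | no c′≰c with ℚₚ.<-dense (ℚₚ.≰⇒> c′≰c)
  ... | r , c<r , r<c′ with g-small (r ℚ.- c) (ε-positive c<r)
    where
    ε-positive : ∀ {x y} → x ℚ.< y → 0ℚ ℚ.< y ℚ.- x
    ε-positive {x} {y} x<y = subst (ℚ._< (y ℚ.- x)) (ℚₚ.+-inverseʳ x) (ℚₚ.+-monoˡ-< (ℚ.- x) x<y)
  ... | M , small with h (suc M)
  ... | G , G∈ , w , lp , M<E , le = ⊥-elim (ℚₚ.<-irrefl refl (ℚₚ.<-≤-trans r<c′ c′≤r))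
    where
    e : ℚ.ℚ
    e = ℤtoℚ (numEdges G)
    m : ℕ
    m = ℤ.∣ numEdges G ∣
    m≡ : m ≡ #edges G
    m≡ = cong ℤ.∣_∣ (numEdges≡ G)
    e≡ : e ≡ ℕtoℚ m
    e≡ = cong ℤtoℚ (trans (numEdges≡ G) (cong +_ (≡-sym m≡)))
    e-positive : ∀ {j} → suc M ≤ j → ℚ.Positive (ℕtoℚ j)
    e-positive {suc j} _ = ℕtoℚ-pos j
    c′e≤re : c′ ℚ.* e ℚ.≤ r ℚ.* e
    c′e≤re = begin
      c′ ℚ.* e                                ≡⟨ add-back (c′ ℚ.* e) (g m) ⟩
      (c′ ℚ.* e ℚ.- g m) ℚ.+ g m              ≤⟨ ℚₚ.+-mono-≤ (adm G G∈ w lp) (p≤∣p∣ (g m)) ⟩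
      ℤtoℚ (wG G w) ℚ.+ ℚ.∣ g m ∣             ≤⟨ ℚₚ.+-mono-≤ (ratio-≥ {G} {w} le)
        (small m (≤-trans (<⇒≤ M<E) (≤-reflexive (≡-sym m≡)))) ⟩
      c ℚ.* e ℚ.+ (r ℚ.- c) ℚ.* ℕtoℚ m        ≡⟨ cong (λ x → c ℚ.* e ℚ.+ (r ℚ.- c) ℚ.* x) e≡ ⟨
      c ℚ.* e ℚ.+ (r ℚ.- c) ℚ.* e             ≡⟨ collect c e r ⟩
      r ℚ.* e                                 ∎
      where
      open ℚₚ.≤-Reasoning
      open +-*-Solver
      add-back : ∀ x y → x ≡ (x ℚ.- y) ℚ.+ y
      add-back = solve 2 (λ x y → x := (x :- y) :+ y) refl
      collect : ∀ c e r → c ℚ.* e ℚ.+ (r ℚ.- c) ℚ.* e ≡ r ℚ.* e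
      collect = solve 3 (λ c e r → c :* e :+ (r :- c) :* e := r :* e) refl
    c′≤r : c′ ℚ.≤ r
    c′≤r = ℚₚ.*-cancelʳ-≤-pos e {{subst ℚ.Positive (≡-sym e≡) (e-positive (≤-trans M<E (≤-reflexive (≡-sym m≡))))}} c′e≤re

-- Spiders

childEdge : (ℕ → ℕ) → ℕ → ℕ → Bool
childEdge par i zero    = false
childEdge par i (suc y) = ⌊ i ℕₚ.≟ par y ⌋

argmax : ∀ {m n} (f : Fin (suc m) → Fin n) → ∃ λ i → ∀ j → f j Fin.≤ f i
argmax {zero}  f = Fin.zero , λ { Fin.zero → ≤-refl }
argmax {suc m} f with argmax (f ∘ Fin.suc)
... | i , max with ℕₚ.≤-total (toℕ (f Fin.zero)) (toℕ (f (Fin.suc i)))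
... | inj₁ f0≤ = Fin.suc i , λ { Fin.zero → f0≤ ; (Fin.suc j) → max j }
... | inj₂ ≤f0 = Fin.zero , λ { Fin.zero → ≤-refl ; (Fin.suc j) → ≤-trans (max j) ≤f0 }

-- The tree on {0, …, L} in which the parent of y + 1 is par y.
module ParentTree (L : ℕ) (par : ℕ → ℕ) (par≤ : ∀ y → par y ≤ y) where

  child≢ : ∀ i → childEdge par i i ≡ false
  child≢ zero = refl
  child≢ (suc y) with suc y ℕₚ.≟ par y
  ... | yes eq = contradiction (≤-trans (≤-reflexive eq) (par≤ y)) (<⇒≱ ≤-refl)
  ... | no _   = refl

  tree : Graph
  tree = record
    { n      = suc L
    ; adj    = λ i j → childEdge par (toℕ i) (toℕ j) Bool.∨ childEdge par (toℕ j) (toℕ i)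
    ; sym    = λ i j → Boolₚ.∨-comm (childEdge par (toℕ i) (toℕ j)) _
    ; irrefl = λ i → cong (λ b → b Bool.∨ b) (child≢ (toℕ i))
    }

  adj⁻ : ∀ {i j} → i Fin.< j → adj tree i j ≡ true → ∃ λ y → toℕ j ≡ suc y × toℕ i ≡ par y
  adj⁻ {i} {j} i<j eq = split (toℕ i) (toℕ j) i<j eq
    where
    split : ∀ x y → x < y → childEdge par x y Bool.∨ childEdge par y x ≡ true → ∃ λ z → y ≡ suc z × x ≡ par z
    split x (suc y) x<y eq with x ℕₚ.≟ par y
    ... | yes x≡ = y , refl , x≡
    split (suc x) (suc y) x<y eq | no _ =
      contradiction (≤-trans (≤-reflexive (⌊⌋-true⁻ (suc y ℕₚ.≟ par x) eq)) (par≤ x)) (<⇒≱ (<-trans (n<1+n x) x<y))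

  adj⁺ : ∀ {i j y} → toℕ j ≡ suc y → toℕ i ≡ par y → adj tree i j ≡ true
  adj⁺ {i} {j} {y} j≡ i≡ rewrite j≡ | ⌊⌋-true⁺ (toℕ i ℕₚ.≟ par y) i≡ = refl

  parent< : ∀ {i j : Fin (suc L)} {y} → toℕ j ≡ suc y → toℕ i ≡ par y → i Fin.< j
  parent< {y = y} j≡ i≡ = ≤-trans (s≤s (≤-trans (≤-reflexive i≡) (par≤ y))) (≤-reflexive (≡-sym j≡))

  -- An edge is named by its larger endpoint, shifted so that the names are exactly 0 to L - 1.
  -- Counting edges becomes counting numbers.
  child : Edge (suc L) → ℕ
  child = pred ∘ toℕ ∘ proj₂

  tree-edge : ∀ {i j} → (i , j) ∈ edges (adj tree) → toℕ j ≡ suc (child (i , j)) × toℕ i ≡ par (child (i , j))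
  tree-edge e∈ with ∈-edges⁻ e∈
  ... | i<j , eq with adj⁻ i<j eq
  ... | y , j≡ , i≡ = trans j≡ (cong suc y≡) , trans i≡ (cong par y≡)
    where y≡ = ≡-sym (cong pred j≡)

  edge-above : ∀ {y} → y < L → ∃ λ e → e ∈ edges (adj tree) × child e ≡ y
  edge-above {y} y<L = (i , j) , ∈-edges⁺ {E = adj tree} (parent< {i} {j} j≡ i≡) (adj⁺ {i} {j} j≡ i≡) , cong pred j≡
    where
    par< : par y < suc L
    par< = s≤s (≤-trans (par≤ y) (<⇒≤ y<L))
    i = Fin.fromℕ< par<
    j = Fin.fromℕ< (s≤s y<L)
    i≡ : toℕ i ≡ par y
    i≡ = Finₚ.toℕ-fromℕ< par<
    j≡ : toℕ j ≡ suc y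
    j≡ = Finₚ.toℕ-fromℕ< (s≤s y<L)

  child< : ∀ {e} → e ∈ edges (adj tree) → child e < L
  child< {i , j} e∈ = s≤s⁻¹ (≤-trans (≤-reflexive (cong suc (≡-sym (proj₁ (tree-edge e∈))))) (Finₚ.toℕ<n j))

  child-injective : ∀ {e e′} → e ∈ edges (adj tree) → e′ ∈ edges (adj tree) → child e ≡ child e′ → e ≡ e′
  child-injective e∈ e′∈ eq with tree-edge e∈ | tree-edge e′∈
  ... | j≡ , i≡ | j′≡ , i′≡ = cong₂ _,_
    (Finₚ.toℕ-injective (trans i≡ (trans (cong par eq) (≡-sym i′≡))))
    (Finₚ.toℕ-injective (trans j≡ (trans (cong suc eq) (≡-sym j′≡))))

  reach-root : ∀ m (v : Fin (suc L)) → toℕ v ≤ m → Reach (edges (adj tree)) v Fin.zero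
  reach-root m       Fin.zero    _    = stay
  reach-root (suc m) (Fin.suc v) v≤ with edge-above (Finₚ.toℕ<n v)
  ... | (i , j) , e∈ , eq with tree-edge e∈
  ... | j≡ , i≡ with Finₚ.toℕ-injective {i = j} {Fin.suc v} (trans j≡ (cong suc eq))
  ... | refl = move (inj₂ e∈) (reach-root m i
    (≤-trans (≤-reflexive i≡) (≤-trans (par≤ (toℕ v)) (s≤s⁻¹ v≤))))

  tree-connected : IsConnected tree
  tree-connected = Fin.zero , λ u v → reach⇒walk (reach-++ (reach-root L u (Finₚ.toℕ≤pred[n] u))
    (reach-sym (reach-root L v (Finₚ.toℕ≤pred[n] v))))

  -- The largest vertex of a cycle would have two different parents.
  tree-acyclic : ¬ HasCycle tree
  tree-acyclic (l , f , f-inj , steps , close) with argmax f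
  ... | i , max = let j , k , j≢k , ji , ki = neighbours i in j≢k (f-inj (same-parent ji ki))
    where
    flip-adj : ∀ u v → adj tree u v ≡ true → adj tree v u ≡ true
    flip-adj u v eq = trans (Graph.sym tree v u) eq
    neighbours : ∀ i → ∃₂ λ j k → j ≢ k × adj tree (f j) (f i) ≡ true × adj tree (f k) (f i) ≡ true
    neighbours Fin.zero = Fin.suc Fin.zero , Fin.fromℕ (suc (suc l)) , (λ ()) ,
      flip-adj (f Fin.zero) (f (Fin.suc Fin.zero)) (steps Fin.zero) , close
    neighbours (Fin.suc i) with Top.view i
    ... | Top.‵fromℕ = Fin.inject₁ (Fin.fromℕ (suc l)) , Fin.zero , (λ ()) ,
      steps (Fin.fromℕ (suc l)) , flip-adj (f (Fin.suc (Fin.fromℕ (suc l)))) (f Fin.zero) close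
    ... | Top.‵inject₁ i′ = Fin.inject₁ (Fin.inject₁ i′) , Fin.suc (Fin.suc i′) ,
      (λ eq → <⇒≢ (<-trans (n<1+n _) (n<1+n _)) (trans (≡-sym (toℕ-inject i′)) (cong toℕ eq))) ,
      steps (Fin.inject₁ i′) , flip-adj (f (Fin.suc (Fin.inject₁ i′))) (f (Fin.suc (Fin.suc i′))) (steps (Fin.suc i′))
      where
      toℕ-inject : ∀ {m} (i : Fin m) → toℕ (Fin.inject₁ (Fin.inject₁ i)) ≡ toℕ i
      toℕ-inject i = trans (Finₚ.toℕ-inject₁ (Fin.inject₁ i)) (Finₚ.toℕ-inject₁ i)
    below : ∀ {j} → adj tree (f j) (f i) ≡ true → f j Fin.< f i
    below {j} eq = ≤∧≢⇒< (max j) λ fj≡fi → case trans (≡-sym eq)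
      (trans (cong (λ v → adj tree v (f i)) (Finₚ.toℕ-injective fj≡fi)) (irrefl tree (f i))) of λ ()
    same-parent : ∀ {j k} → adj tree (f j) (f i) ≡ true → adj tree (f k) (f i) ≡ true → f j ≡ f k
    same-parent ji ki with adj⁻ (below ji) ji | adj⁻ (below ki) ki
    ... | y , i≡ , j≡ | z , i≡′ , k≡ = Finₚ.toℕ-injective
      (trans j≡ (trans (cong par (ℕₚ.suc-injective (trans (≡-sym i≡) i≡′))) (≡-sym k≡)))

  tree-isTree : IsTree tree
  tree-isTree = tree-connected , tree-acyclic

unique-map : ∀ {A B : Set} {f : A → B} {xs} → Unique xs →
  (∀ {x y} → x ∈ xs → y ∈ xs → f x ≡ f y → x ≡ y) → Unique (map f xs)
unique-map []                      inj = []
unique-map {f = f} {x ∷ xs} (x∉ ∷ xs!) inj =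
  unique-∷ (λ fx∈ → let y , y∈ , fx≡fy = ∈-map⁻ f fx∈ in All.lookup x∉ y∈ (inj (here refl) (there y∈) fx≡fy))
    (unique-map xs! λ x∈ y∈ → inj (there x∈) (there y∈))

module _ {d : ℕ} where

  private
    D = suc d

  %-leg : ∀ b {t} → t < D → (b * D + t) % D ≡ t
  %-leg b {t} t<D = trans (cong (_% D) (+-comm (b * D) t)) (trans ([m+kn]%n≡m%n t b D) (m<n⇒m%n≡m t<D))

  /-leg : ∀ b {t} → t < D → (b * D + t) / D ≡ b
  /-leg b {t} t<D = *-cancelʳ-≡ _ _ D (+-cancelˡ-≡ t _ _ (begin
    t + (b * D + t) / D * D                       ≡⟨ cong (_+ (b * D + t) / D * D) (%-leg b t<D) ⟨
    (b * D + t) % D + (b * D + t) / D * D         ≡⟨ m≡m%n+[m/n]*n (b * D + t) D ⟨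
    b * D + t                                     ≡⟨ +-comm (b * D) t ⟩
    t + b * D                                     ∎))
    where open ≡-Reasoning

  leg : ∀ x → x ≡ x / D * D + x % D
  leg x = trans (m≡m%n+[m/n]*n x D) (+-comm (x % D) _)

-- A spider with T legs of p + a edges each, the outer a edges of every leg being negative, except that the first leg
-- is shortened by its δ innermost edges. Adding δ to the number of a vertex (root excluded) gives its position when
-- the legs are laid out one after the other.
module Spider (p′ a δ T′ : ℕ) (δ≤p′ : δ ≤ p′) where

  p D T L : ℕ
  p = suc p′
  D = p + a
  T = suc T′
  L = T * D ∸ δ

  position : ℕ → ℕ
  position y = (y + δ) % D

  -- Position 0 opens a new leg at the root. The shortened leg opens at position δ instead, but
  -- there y = 0, so its parent is the root in either case.
  par : ℕ → ℕ
  par y with position y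
  ... | zero  = 0
  ... | suc _ = y

  par-inner : ∀ {y} → position y ≡ 0 → par y ≡ 0
  par-inner {y} eq rewrite eq = refl

  par-outer : ∀ {y} → position y ≢ 0 → par y ≡ y
  par-outer {y} ≢0 with position y
  ... | zero  = contradiction refl ≢0
  ... | suc _ = refl

  par≤ : ∀ y → par y ≤ y
  par≤ y with position y
  ... | zero  = z≤n
  ... | suc _ = ≤-refl

  open ParentTree L par par≤ public

  δ<D : δ < D
  δ<D = s≤s (≤-trans δ≤p′ (m≤m+n p′ a))

  δ≤TD : δ ≤ T * D
  δ≤TD = ≤-trans (<⇒≤ δ<D) (m≤m+n D (T′ * D))

  L+δ : L + δ ≡ T * D
  L+δ = m∸n+n≡m δ≤TD

  weighing : Weighing tree
  weighing i j = if ⌊ position (pred (toℕ j)) ℕₚ.<? p ⌋ then Sign.+ else Sign.-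

  negative⁻ : ∀ {e} → Negative weighing e → p ≤ position (child e)
  negative⁻ {e} e- with position (child e) ℕₚ.<? p
  ... | no ≮p = ≮⇒≥ ≮p

  negative⁺ : ∀ {e} → p ≤ position (child e) → Negative weighing e
  negative⁺ {e} p≤ with position (child e) ℕₚ.<? p
  ... | yes <p = contradiction p≤ (<⇒≱ <p)
  ... | no _   = refl

  #edges≡ : #edges tree ≡ L
  #edges≡ = ≤-antisym
    (begin
      #edges tree                         ≡⟨ length-map child (edges (adj tree)) ⟨
      length (map child (edges (adj tree))) ≤⟨ unique-⊆-length (unique-map (edges-unique (adj tree)) child-injective)
        (λ y∈ → case ∈-map⁻ child y∈ of λ { (e , e∈ , refl) → ∈-upTo⁺ (child< e∈) }) ⟩
      length (upTo L)                     ≡⟨ length-upTo L ⟩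
      L                                   ∎)
    (s≤s⁻¹ (#edges-≥ tree tree-connected))
    where open ≤-Reasoning

  -- One direction is enough: with the total `L` known, it also bounds the positive edges from
  -- above.
  #neg-≥ : T * a ≤ #neg tree weighing
  #neg-≥ = begin
    T * a                                        ≡⟨ cong (_* a) (length-upTo T) ⟨
    length (upTo T) * a                          ≡⟨ sum-const (upTo T) ⟨
    sum (map (length ∘ outer) (upTo T))          ≡⟨ length-concatMap outer (upTo T) ⟨
    length (concatMap outer (upTo T))            ≤⟨ unique-⊆-length outer! outer⊆ ⟩
    length (map child (neg weighing (edges (adj tree)))) ≡⟨ length-map child (neg weighing (edges (adj tree))) ⟩
    #neg tree weighing                           ∎
    where
    open ≤-Reasoning
    outer : ℕ → List ℕ
    -- The offset p ∸ δ cancels the δ in `position`: these are the y with y + δ = b D + p + t.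
    outer b = map (λ t → b * D + (p ∸ δ) + t) (upTo a)
    sum-const : ∀ bs → sum (map (length ∘ outer) bs) ≡ length bs * a
    sum-const []       = refl
    sum-const (b ∷ bs) = cong₂ _+_ (trans (length-map _ (upTo a)) (length-upTo a)) (sum-const bs)
    shift : ∀ b t → b * D + (p ∸ δ) + t + δ ≡ b * D + (p + t)
    shift b t = trans (arith (b * D) (p ∸ δ) t δ) (cong (λ l → b * D + (l + t)) (m∸n+n≡m (≤-trans δ≤p′ (n≤1+n p′))))
      where
      arith : ∀ x y t d → x + y + t + d ≡ x + ((y + d) + t)
      arith = solve-∀
    outer-∈ : ∀ {b y} → y ∈ outer b → ∃ λ t → t < a × y + δ ≡ b * D + (p + t)
    outer-∈ {b} y∈ with ∈-map⁻ _ y∈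
    ... | t , t∈ , refl = t , ∈-upTo⁻ t∈ , shift b t
    outer! : Unique (concatMap outer (upTo T))
    outer! = concatMap-unique (Uniqueₚ.upTo⁺ T)
      (λ b → Uniqueₚ.map⁺ (λ {x} {y} → +-cancelˡ-≡ (b * D + (p ∸ δ)) x y) (Uniqueₚ.upTo⁺ a))
      λ {b} {c} y∈b y∈c → let t , t<a , y≡ = outer-∈ {b} y∈b ; s , s<a , y≡′ = outer-∈ {c} y∈c in
        trans (≡-sym (/-leg b (+-monoʳ-< p t<a)))
          (trans (cong (_/ D) (trans (≡-sym y≡) y≡′)) (/-leg c (+-monoʳ-< p s<a)))
    outer⊆ : concatMap outer (upTo T) ⊆ map child (neg weighing (edges (adj tree)))
    outer⊆ {y} y∈ with ∈-concatMap⁻′ outer {upTo T} y∈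
    ... | b , b∈ , y∈b with outer-∈ {b} y∈b
    ... | t , t<a , y≡ with edge-above {y} (+-cancelʳ-< δ y L (begin-strict
      y + δ              ≡⟨ y≡ ⟩
      b * D + (p + t)    <⟨ +-monoʳ-< (b * D) (+-monoʳ-< p t<a) ⟩
      b * D + D          ≡⟨ +-comm (b * D) D ⟩
      suc b * D          ≤⟨ *-monoˡ-≤ D (∈-upTo⁻ b∈) ⟩
      T * D              ≡⟨ L+δ ⟨
      L + δ              ∎))
    ... | e , e∈ , refl = ∈-map⁺ child (∈-filter⁺ (negative? weighing) e∈ (negative⁺ {e} (begin
      p                        ≤⟨ m≤m+n p t ⟩
      p + t                    ≡⟨ %-leg b (+-monoʳ-< p t<a) ⟨
      (b * D + (p + t)) % D    ≡⟨ cong (_% D) y≡ ⟨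
      position (child e)       ∎)))

  -- The vertices of leg `b` at position `j` or further out, where `m` = y + 1. They hang from the
  -- rest of the tree by the single edge named y₀ with y₀ + δ = b D + j.
  Inside : ℕ → ℕ → Pred ℕ Level.zero
  Inside b j m = 1 ≤ m × b * D + j ≤ pred m + δ × pred m + δ < b * D + D

  inside? : ∀ b j → Decidable (Inside b j)
  inside? b j m = (1 ≤? m) ×-dec (b * D + j ≤? pred m + δ) ×-dec (pred m + δ ℕₚ.<? b * D + D)

  position-inside : ∀ {b y} → b * D ≤ y + δ → y + δ < b * D + D → y + δ ≡ b * D + position y
  position-inside {b} {y} lo hi = trans (≡-sym split) (cong (_+_ (b * D)) (≡-sym (trans (cong (_% D) (≡-sym split)) (%-leg b t<D))))
    where
    split : b * D + (y + δ ∸ b * D) ≡ y + δ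
    split = m+[n∸m]≡n lo
    t<D : y + δ ∸ b * D < D
    t<D = +-cancelˡ-< (b * D) _ _ (≤-<-trans (≤-reflexive split) hi)

  module _ {b j y₀} (y₀+δ : y₀ + δ ≡ b * D + j) where

    enter : ∀ {y} → Inside b j (suc y) → ¬ Inside b j (par y) → y ≡ y₀
    enter {y} (_ , lo , hi) outside with position y ℕₚ.≟ 0
    ... | yes pos≡0 = +-cancelʳ-≡ δ y y₀ (trans at-start (≡-sym (trans y₀+δ (cong (_+_ (b * D)) j≡0))))
      where
      at-start : y + δ ≡ b * D + 0
      at-start = trans (position-inside {b} (≤-trans (m≤m+n (b * D) j) lo) hi) (cong (_+_ (b * D)) pos≡0)
      j≡0 : j ≡ 0
      j≡0 = n≤0⇒n≡0 (+-cancelˡ-≤ (b * D) j 0 (≤-trans lo (≤-reflexive at-start)))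
    -- The first edge of the shortened leg: it starts at the root although its position is not 0.
    enter {zero} (_ , lo , hi) outside | no pos≢0 =
      ≡-sym (n≤0⇒n≡0 (+-cancelʳ-≤ δ y₀ 0 (≤-trans (≤-reflexive y₀+δ) lo)))
    enter {suc y} (_ , lo , hi) outside | no pos≢0 =
      +-cancelʳ-≡ δ (suc y) y₀ (trans (≤-antisym (≰⇒> below) lo) (≡-sym y₀+δ))
      where
      below : ¬ b * D + j ≤ y + δ
      below lo′ = outside (subst (Inside b j) (≡-sym (par-outer pos≢0)) (s≤s z≤n , lo′ , <-trans (n<1+n _) hi))

    -- Running past the end of a leg means reaching position 0 of the next one, and the parent there
    -- is the root, which is not inside.
    no-leave : ∀ {y} → Inside b j (par y) → Inside b j (suc y)
    no-leave {zero}  inside = contradiction (proj₁ inside) (<⇒≱ (s≤s (par≤ 0)))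
    no-leave {suc y} inside with position (suc y) ℕₚ.≟ 0
    ... | yes pos≡0 = case proj₁ (subst (Inside b j) (par-inner {suc y} pos≡0) inside) of λ ()
    ... | no pos≢0  =
      let _ , lo , hi = subst (Inside b j) (par-outer {suc y} pos≢0) inside
      in s≤s z≤n , ≤-trans lo (n≤1+n _) , ≤∧≢⇒< hi λ at-end →
        pos≢0 (trans (cong (_% D) (trans at-end (trans (+-comm (b * D) D) (≡-sym (+-identityʳ (suc b * D))))))
          (%-leg {p′ + a} (suc b) (s≤s z≤n)))

  module _ (H : Subgraph tree) (H-connected : IsConnectedSub H) where

    H-edges : List (Edge (suc L))
    H-edges = edges (es H)

    H-tree : ∀ {e} → e ∈ H-edges → e ∈ edges (adj tree)
    H-tree e∈ with ∈-edges⁻ e∈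
    ... | i<j , eij = ∈-edges⁺ i<j (proj₁ (sub H _ _ i<j eij))

    H-child : ∀ {e} → e ∈ H-edges → vs H (proj₂ e) ≡ true
    H-child e∈ with ∈-edges⁻ e∈
    ... | i<j , eij = proj₂ (proj₂ (sub H _ _ i<j eij))

    cut : ∀ {b j y₀} → y₀ + δ ≡ b * D + j → ∀ {u v} → vs H u ≡ true → vs H v ≡ true →
      Inside b j (toℕ u) → ¬ Inside b j (toℕ v) → ∃ λ e → e ∈ H-edges × child e ≡ y₀
    cut {b} {j} y₀+δ {u} {v} u∈ v∈ inside outside
      with reach-exit (inside? b j ∘ toℕ) (walk⇒reach (proj₂ H-connected u v u∈ v∈)) inside outside
    ... | x , y , inj₂ e∈ , x-in , y-out with tree-edge (H-tree e∈)
    ...   | x≡ , y≡ = _ , e∈ , enter {b} {j} y₀+δ (subst (Inside b j) x≡ x-in) (y-out ∘ subst (Inside b j) (≡-sym y≡))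
    cut {b} {j} y₀+δ u∈ v∈ inside outside | x , y , inj₁ e∈ , x-in , y-out with tree-edge (H-tree e∈)
    ...   | y≡ , x≡ = contradiction
      (subst (Inside b j) (≡-sym y≡) (no-leave {b} {j} y₀+δ (subst (Inside b j) x≡ x-in))) y-out

    leg-of : Edge (suc L) → ℕ
    leg-of e = (child e + δ) / D

    leg-bounds : ∀ e → leg-of e * D + position (child e) ≡ child e + δ × position (child e) < D
    leg-bounds e = ≡-sym (leg (child e + δ)) , m%n<n (child e + δ) D

    -- Every positive edge of the leg of `e` separates `e`, further out, from `e′` in another leg,
    -- so `cut` puts it in `H`. In leg 0 the equation for y₀ excludes the removed positions j < δ.
    arm : ∀ {e e′} → e ∈ neg weighing H-edges → e′ ∈ neg weighing H-edges → leg-of e ≢ leg-of e′ →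
      ∀ {j y₀} → j < p → y₀ + δ ≡ leg-of e * D + j → y₀ ∈ map child (pos weighing H-edges)
    arm {e} {e′} e∈ e′∈ legs≢ {j} {y₀} j<p y₀+δ =
      let e∈H  , e-  = ∈-filter⁻ (negative? weighing) {xs = H-edges} e∈
          e′∈H , _   = ∈-filter⁻ (negative? weighing) {xs = H-edges} e′∈
          b = leg-of e
          c≡ , c<D   = leg-bounds e
          e-inside   = subst (Inside b j) (≡-sym (proj₁ (tree-edge (H-tree e∈H))))
            ( s≤s z≤n
            , ≤-trans (+-monoʳ-≤ (b * D) (≤-trans (<⇒≤ j<p) (negative⁻ {e} e-))) (≤-reflexive c≡)
            , ≤-<-trans (≤-reflexive (≡-sym c≡)) (+-monoʳ-< (b * D) c<D))
          e′-outside = λ inside → let _ , lo , hi = subst (Inside b j) (proj₁ (tree-edge (H-tree e′∈H))) inside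
                                      x≡ = position-inside {b} (≤-trans (m≤m+n (b * D) j) lo) hi
            in legs≢ (≡-sym (trans (cong (_/ D) x≡) (/-leg b (proj₂ (leg-bounds e′)))))
          e″ , e″∈ , ch = cut {b} {j} y₀+δ (H-child e∈H) (H-child e′∈H) e-inside e′-outside
          pos≡j = trans (cong (_% D) (trans (cong (_+ δ) ch) y₀+δ)) (%-leg b (<-≤-trans j<p (m≤m+n p a)))
      in subst (_∈ map child (pos weighing H-edges)) ch (∈-map⁺ child
           (∈-filter⁺ (¬? ∘ negative? weighing) e″∈
             (λ neg → <⇒≱ (≤-<-trans (≤-reflexive pos≡j) j<p) (negative⁻ {e″} neg))))

    -- Only leg 0 is shortened. The leg of `e′` has a larger number, so it contributes all `p`
    -- positive edges, and the leg of `e` at least p ∸ δ.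
    two-arms : ∀ {e e′} → e ∈ neg weighing H-edges → e′ ∈ neg weighing H-edges → leg-of e < leg-of e′ →
      (p ∸ δ) + p ≤ length (pos weighing H-edges)
    two-arms {e} {e′} e∈ e′∈ leg< with leg-of e in b≡ | leg-of e′ in c≡
    ... | b | suc c = begin
      (p ∸ δ) + p                          ≡⟨ cong₂ _+_ (trans (length-map _ (upTo (p ∸ δ))) (length-upTo (p ∸ δ))) (trans (length-map _ (upTo p)) (length-upTo p)) ⟨
      length first + length second         ≡⟨ length-++ first ⟨
      length (first ++ second)             ≤⟨ unique-⊆-length arms! arms⊆ ⟩
      length (map child (pos weighing H-edges)) ≡⟨ length-map child (pos weighing H-edges) ⟩
      length (pos weighing H-edges)        ∎
      where
      open ≤-Reasoning
      first second : List ℕ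
      first  = map (λ t → b * D + t) (upTo (p ∸ δ))
      -- The name of the first edge of leg c + 1 is (c + 1) D - δ, written with δ subtracted from a
      -- single D.
      second = map (λ t → c * D + (D ∸ δ) + t) (upTo p)
      position-first : ∀ t → b * D + t + δ ≡ b * D + (t + δ)
      position-first t = +-assoc (b * D) t δ
      position-second : ∀ t → c * D + (D ∸ δ) + t + δ ≡ suc c * D + t
      position-second t = trans (arith (c * D) (D ∸ δ) t δ) (cong (λ l → l + c * D + t) (m∸n+n≡m (<⇒≤ δ<D)))
        where
        arith : ∀ x y t d → x + y + t + d ≡ ((y + d) + x) + t
        arith = solve-∀
      first-∈ : ∀ {y} → y ∈ first → ∃ λ t → t + δ < p × y + δ ≡ b * D + (t + δ)
      first-∈ y∈ with ∈-map⁻ _ y∈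
      ... | t , t∈ , refl = t ,
        <-≤-trans (+-monoˡ-< δ (∈-upTo⁻ t∈)) (≤-reflexive (m∸n+n≡m (≤-trans δ≤p′ (n≤1+n p′)))) , position-first t
      second-∈ : ∀ {y} → y ∈ second → ∃ λ t → t < p × y + δ ≡ suc c * D + t
      second-∈ y∈ with ∈-map⁻ _ y∈
      ... | t , t∈ , refl = t , ∈-upTo⁻ t∈ , position-second t
      p≤D : p ≤ D
      p≤D = m≤m+n p a
      arms! : Unique (first ++ second)
      arms! = Uniqueₚ.++⁺
        (Uniqueₚ.map⁺ (λ {x} {y} → +-cancelˡ-≡ (b * D) x y) (Uniqueₚ.upTo⁺ (p ∸ δ)))
        (Uniqueₚ.map⁺ (λ {x} {y} → +-cancelˡ-≡ (c * D + (D ∸ δ)) x y) (Uniqueₚ.upTo⁺ p))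
        λ (y∈₁ , y∈₂) → let t , t<p , y≡ = first-∈ y∈₁ ; s , s<p , y≡′ = second-∈ y∈₂ in
          <⇒≢ leg< (trans (≡-sym (/-leg b (<-≤-trans t<p p≤D)))
            (trans (cong (_/ D) (trans (≡-sym y≡) y≡′)) (/-leg (suc c) (<-≤-trans s<p p≤D))))
      legs≢ : leg-of e ≢ leg-of e′
      legs≢ eq = <⇒≢ leg< (trans (≡-sym b≡) (trans eq c≡))
      arms⊆ : first ++ second ⊆ map child (pos weighing H-edges)
      arms⊆ y∈ with ∈-++⁻ first y∈
      ... | inj₁ y∈₁ = let t , t<p , y≡ = first-∈ y∈₁ in
        arm {e} {e′} e∈ e′∈ legs≢ t<p (trans y≡ (cong (λ l → l * D + (t + δ)) (≡-sym b≡)))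
      ... | inj₂ y∈₂ = let t , t<p , y≡ = second-∈ y∈₂ in
        arm {e′} {e} e′∈ e∈ (legs≢ ∘ ≡-sym) t<p (trans y≡ (cong (λ l → l * D + t) (≡-sym c≡)))

    -- Within one leg the position determines the edge, and negative edges occupy only the `a`
    -- positions from `p` to D - 1.
    same-leg : ∀ b → All (λ e → leg-of e ≡ b) (neg weighing H-edges) → length (neg weighing H-edges) ≤ a
    same-leg b all≡b = begin
      length (neg weighing H-edges)                        ≡⟨ length-map (position ∘ child) (neg weighing H-edges) ⟨
      length (map (position ∘ child) (neg weighing H-edges)) ≤⟨ unique-⊆-length
        (unique-map (neg-unique weighing (edges-unique (es H))) position-injective) positions⊆ ⟩
      length (map (_+_ p) (upTo a))                        ≡⟨ trans (length-map (_+_ p) (upTo a)) (length-upTo a) ⟩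
      a                                                    ∎
      where
      open ≤-Reasoning
      in-H : ∀ {e} → e ∈ neg weighing H-edges → e ∈ H-edges
      in-H = proj₁ ∘ ∈-filter⁻ (negative? weighing) {xs = H-edges}
      position-injective : ∀ {e e′} → e ∈ neg weighing H-edges → e′ ∈ neg weighing H-edges →
        position (child e) ≡ position (child e′) → e ≡ e′
      position-injective {e} {e′} e∈ e′∈ eq = child-injective (H-tree (in-H e∈)) (H-tree (in-H e′∈))
        (+-cancelʳ-≡ δ (child e) (child e′) (trans (≡-sym (proj₁ (leg-bounds e)))
          (trans (cong₂ (λ l t → l * D + t) (trans (All.lookup all≡b e∈) (≡-sym (All.lookup all≡b e′∈))) eq)
            (proj₁ (leg-bounds e′)))))
      positions⊆ : map (position ∘ child) (neg weighing H-edges) ⊆ map (_+_ p) (upTo a)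
      positions⊆ {t} t∈ with ∈-map⁻ (position ∘ child) t∈
      ... | e , e∈ , refl = subst (_∈ map (_+_ p) (upTo a)) (m+[n∸m]≡n p≤) (∈-map⁺ (_+_ p)
        (∈-upTo⁺ (+-cancelˡ-< p _ a (≤-<-trans (≤-reflexive (m+[n∸m]≡n p≤)) (proj₂ (leg-bounds e))))))
        where
        p≤ : p ≤ position (child e)
        p≤ = negative⁻ {e} (proj₂ (∈-filter⁻ (negative? weighing) {xs = H-edges} e∈))

    -- If the negative edges meet two legs, the two arms use up all but `a` of the available edges;
    -- otherwise a single leg supplies at most `a`.
    few-negative : length H-edges ≤ a + ((p ∸ δ) + p) → length (neg weighing H-edges) ≤ a
    few-negative k≤ = cases (neg weighing H-edges) refl
      where
      from-arms : (p ∸ δ) + p ≤ length (pos weighing H-edges) → length (neg weighing H-edges) ≤ a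
      from-arms arms≤ = +-cancelʳ-≤ (length (pos weighing H-edges)) _ a
        (≤-trans (≤-reflexive (≡-sym (length-neg-pos weighing H-edges))) (≤-trans k≤ (+-monoʳ-≤ a arms≤)))
      cases : ∀ es → neg weighing H-edges ≡ es → length (neg weighing H-edges) ≤ a
      cases [] eq = subst (λ es → length es ≤ a) (≡-sym eq) z≤n
      cases (e ∷ es) eq with All.all? (λ e′ → leg-of e′ ℕₚ.≟ leg-of e) (neg weighing H-edges)
      ... | yes all≡ = same-leg (leg-of e) all≡
      ... | no ¬all≡ with find (Allₚ.¬All⇒Any¬ (λ e′ → leg-of e′ ℕₚ.≟ leg-of e) _ ¬all≡)
      ...   | e′ , e′∈ , ≢leg with ℕₚ.<-cmp (leg-of e′) (leg-of e)
      ...     | tri< lt _ _ = from-arms (two-arms e′∈ (subst (e ∈_) (≡-sym eq) (here refl)) lt)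
      ...     | tri≈ _ eq′ _ = contradiction eq′ ≢leg
      ...     | tri> _ _ gt = from-arms (two-arms (subst (e ∈_) (≡-sym eq) (here refl)) e′∈ gt)

  spider-positive : ∀ {k} → a + a < k → k ≤ a + ((p ∸ δ) + p) → LocalPositive tree k weighing
  spider-positive {k} 2a<k k≤ H H-connected count≡ =
    subst (ℤ._<_ (+ 0)) (≡-sym (weightOn-edges tree weighing (es H)))
      (ℤₚ.<-≤-trans (ℤ.+<+ (s≤s z≤n)) (diff-≤ 0 1 (≤-trans neg<pos (m≤m+n _ 0))))
    where
    open ≤-Reasoning
    |H|≡k : length (edges (es H)) ≡ k
    |H|≡k = ℤₚ.+-injective (trans (≡-sym (edgeCount-edges (es H))) count≡)
    neg≤a : length (neg weighing (edges (es H))) ≤ a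
    neg≤a = few-negative H H-connected (≤-trans (≤-reflexive |H|≡k) k≤)
    neg<pos : length (neg weighing (edges (es H))) < length (pos weighing (edges (es H)))
    neg<pos = ≤-<-trans neg≤a (+-cancelˡ-< a _ _ (begin-strict
      a + a ≡⟨⟩
      a + a <⟨ 2a<k ⟩
      k     ≡⟨ |H|≡k ⟨
      length (edges (es H)) ≡⟨ length-neg-pos weighing (edges (es H)) ⟩
      length (neg weighing (edges (es H))) + length (pos weighing (edges (es H))) ≤⟨ +-monoˡ-≤ _ neg≤a ⟩
      a + length (pos weighing (edges (es H))) ∎))

-- Upper bounds from spiders

wG-≤ : ∀ G c d {w} → #pos G w + d ≤ c + #neg G w → wG G w ℤ.≤ + c ℤ.- + d
wG-≤ G c d {w} le = subst (ℤ._≤ (+ c ℤ.- + d)) (≡-sym (wG≡ G w)) (diff-≤ (#neg G w) (#pos G w) le)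

module _ {𝒢 : Family} (trees : ∀ G → IsTree G → 𝒢 G) where

  module _ {k} p′ a δ (δ≤p′ : δ ≤ p′) (2a<k : a + a < k) (k≤ : k ≤ a + ((suc p′ ∸ δ) + suc p′)) where

    abstract
      spiders : ∀ M → ∃ λ G → 𝒢 G × Σ (Weighing G) λ w → LocalPositive G k w × M ≤ #edges G × M ≤ n G ×
        #pos G w + δ ≤ suc M * suc p′ × suc M * a ≤ #neg G w
      spiders M = tree , trees tree tree-isTree , weighing , spider-positive 2a<k k≤ ,
        ≤-trans M≤L (≤-reflexive (≡-sym #edges≡)) , ≤-trans M≤L (n≤1+n L) , pos≤ , #neg-≥
        where
        open Spider p′ a δ M δ≤p′
        open ≤-Reasoning
        M≤L : M ≤ L
        M≤L = begin
          M                  ≤⟨ m≤m*n M D ⟩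
          M * D              ≤⟨ m≤n+m (M * D) (D ∸ δ) ⟩
          (D ∸ δ) + M * D    ≡⟨ +-∸-comm (M * D) (<⇒≤ δ<D) ⟨
          L                  ∎
        pos≤ : #pos tree weighing + δ ≤ suc M * p
        pos≤ = +-cancelʳ-≤ (suc M * a) _ _ (begin
          #pos tree weighing + δ + suc M * a            ≤⟨ +-monoʳ-≤ (#pos tree weighing + δ) #neg-≥ ⟩
          #pos tree weighing + δ + #neg tree weighing   ≡⟨ shuffle (#pos tree weighing) δ (#neg tree weighing) ⟩
          #neg tree weighing + #pos tree weighing + δ   ≡⟨ cong (_+ δ) (trans (≡-sym (#neg+#pos tree weighing)) #edges≡) ⟩
          L + δ                                         ≡⟨ L+δ ⟩
          suc M * (p + a)                               ≡⟨ *-distribˡ-+ (suc M) p a ⟩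
          suc M * p + suc M * a                         ∎)
          where
          shuffle : ∀ x y z → x + y + z ≡ z + x + y
          shuffle = solve-∀

  not-forcing : ∀ {k} p′ a δ (δ≤p′ : δ ≤ p′) → suc p′ ≤ a → a + a < k → k ≤ a + ((suc p′ ∸ δ) + suc p′) →
    ¬ Forcing 𝒢 k
  not-forcing p′ a δ δ≤p′ p≤a 2a<k k≤ (N₀ , h) with spiders p′ a δ δ≤p′ 2a<k k≤ N₀
  ... | G , G∈ , w , lp , _ , N₀≤n , pos≤ , neg≥ =
    ℤₚ.<⇒≱ (h G G∈ N₀≤n w lp) (wG-≤ G 0 0 (≤-trans (≤-reflexive (+-identityʳ _))
      (≤-trans (m+n≤o⇒m≤o (#pos G w) pos≤) (≤-trans (*-monoʳ-≤ (suc N₀) p≤a) neg≥))))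

  -- With a = p every full leg has weight 0, and the shortened leg leaves -δ however many legs there
  -- are.
  not-bound : ∀ {k} p′ δ (δ≤p′ : δ ≤ p′) → suc p′ + suc p′ < k → k ≤ suc p′ + ((suc p′ ∸ δ) + suc p′) →
    ∀ C → + 0 ℤ.- + δ ℤ.< C → ¬ Bound 𝒢 k C
  not-bound p′ δ δ≤p′ 2a<k k≤ C -δ<C (N₀ , h) with spiders p′ (suc p′) δ δ≤p′ 2a<k k≤ N₀
  ... | G , G∈ , w , lp , _ , N₀≤n , pos≤ , neg≥ =
    ℤₚ.<⇒≱ -δ<C (ℤₚ.≤-trans (h G G∈ N₀≤n w lp) (wG-≤ G 0 δ (≤-trans pos≤ neg≥)))

  -- With p < a each leg contributes at most -1, so the weight is unbounded below as legs are added.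
  collapses : ∀ {k} p′ a → suc p′ < a → a + a < k → k ≤ a + (suc p′ + suc p′) → Collapses 𝒢 k
  collapses p′ a p<a 2a<k k≤ = not-forcing p′ a 0 z≤n (<⇒≤ p<a) 2a<k k≤ ,
    λ (_ , C , N₀ , h) → unbounded C N₀ h
    where
    unbounded : ∀ C N₀ → (∀ G → 𝒢 G → N₀ ≤ n G → ∀ w → LocalPositive G _ w → C ℤ.≤ wG G w) → ⊥
    unbounded C N₀ h with spiders p′ a 0 z≤n 2a<k k≤ (N₀ + ℤ.∣ C ∣)
    -- N₀ + |C| + 1 legs make the graph large enough and push its weight below C.
    ... | G , G∈ , w , lp , _ , M≤n , pos≤ , neg≥ =
      impossible C (ℤₚ.≤-trans (h G G∈ (≤-trans (m≤m+n N₀ _) M≤n) w lp) (wG-≤ G 0 (suc M) (begin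
        #pos G w + suc M         ≤⟨ +-monoˡ-≤ (suc M) (m+n≤o⇒m≤o (#pos G w) pos≤) ⟩
        suc M * suc p′ + suc M   ≡⟨ trans (+-comm (suc M * suc p′) (suc M)) (≡-sym (*-suc (suc M) (suc p′))) ⟩
        suc M * suc (suc p′)     ≤⟨ *-monoʳ-≤ (suc M) p<a ⟩
        suc M * a                ≤⟨ neg≥ ⟩
        #neg G w                 ∎)))
      where
      open ≤-Reasoning
      M = N₀ + ℤ.∣ C ∣
      impossible : ∀ C → C ℤ.≤ + 0 ℤ.- + suc (N₀ + ℤ.∣ C ∣) → ⊥
      impossible -[1+ c ] (ℤ.-≤- le) = <⇒≱ (m≤n+m (suc c) N₀) le

  f-equals : ∀ k p′ δ → δ ≤ p′ → suc p′ + suc p′ < k → k ≤ suc p′ + ((suc p′ ∸ δ) + suc p′) →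
    Bound 𝒢 k (+ 0 ℤ.- + δ) → fEquals 𝒢 k (+ 0 ℤ.- + δ)
  f-equals k p′ δ δ≤p′ 2a<k k≤ bound =
    (not-forcing p′ (suc p′) δ δ≤p′ ≤-refl 2a<k k≤ , _ , bound) , bound , not-bound p′ δ δ≤p′ 2a<k k≤

  -- The fraction -u / d = (p - a) / (p + a) is the mean weight of an edge in a leg. After clearing
  -- denominators the claim is 2 a P ≤ 2 p N.
  spider-at-most : ∀ {k} p′ a u d → a ≡ suc p′ + u → d ≡ suc p′ + a → a + a < k →
    k ≤ a + (suc p′ + suc p′) → cAtMost 𝒢 k (ℚ.- frac (+ u) d)
  spider-at-most p′ a u d refl refl 2a<k k≤ = at-most u (p′ + a) λ M →
    let G , G∈ , w , lp , M≤E , _ , pos≤ , neg≥ = spiders p′ a 0 z≤n 2a<k k≤ M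
    in G , G∈ , w , lp , M≤E , ratio {M} {#pos G w} {#neg G w} {#edges G}
         (m+n≤o⇒m≤o (#pos G w) pos≤) neg≥ (#neg+#pos G w)
    where
    ratio : ∀ {M P N E} → P ≤ suc M * suc p′ → suc M * a ≤ N → E ≡ N + P →
      suc (p′ + a) * P + u * E ≤ suc (p′ + a) * N
    ratio {M} {P} {N} pos≤ neg≥ refl = begin
      suc (p′ + a) * P + u * (N + P)               ≡⟨ lhs p′ a u N P ⟩
      (suc p′ + u + a) * P + u * N                 ≤⟨ +-monoˡ-≤ (u * N) (*-monoʳ-≤ (a + a) pos≤) ⟩
      (a + a) * (suc M * suc p′) + u * N           ≡⟨ middle a M p′ (u * N) ⟩
      (suc p′ + suc p′) * (suc M * a) + u * N      ≤⟨ +-monoˡ-≤ (u * N) (*-monoʳ-≤ (suc p′ + suc p′) neg≥) ⟩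
      (suc p′ + suc p′) * N + u * N                ≡⟨ rhs p′ u N ⟩
      suc (p′ + a) * N                             ∎
      where
      open ≤-Reasoning
      lhs : ∀ p a u N P → suc (p + a) * P + u * (N + P) ≡ (suc p + u + a) * P + u * N
      lhs = solve-∀
      middle : ∀ a M p x → (a + a) * (suc M * suc p) + x ≡ (suc p + suc p) * (suc M * a) + x
      middle = solve-∀
      rhs : ∀ p u N → (suc p + suc p) * N + u * N ≡ suc (p + (suc p + u)) * N
      rhs = solve-∀

-- With s = 1 or 2, these parameters turn q N ≤ a (2 P + 1 + q) into (d + u) P + O(1) ≥ (d - u) N.
tour-at-least : ∀ {𝒢 : Family} → (∀ G → 𝒢 G → IsConnected G) → ∀ {k} s a q u d d′ → d ≡ suc d′ →
  d ≡ s * q + u → d + u ≡ s * (2 * a) → 1 ≤ q → k ≤ suc a + suc a → a + q ≤ k →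
  cAtLeast 𝒢 k (ℚ.- frac (+ u) d)
tour-at-least conn {k} s a q u d d′ refl d≡ d+u≡ 1≤q k≤2a a+q≤k =
  -- The first term is the additive constant of the tour bound. The term d k covers graphs with
  -- fewer than k edges, since admissibility concerns every graph of the family.
  at-least u d′ (s * (a * suc q) + d * k) λ G G∈ w lp → bound G (conn G G∈) w lp
  where
  open ≤-Reasoning
  bound : ∀ G → IsConnected G → ∀ w → LocalPositive G k w →
    d * #neg G w ≤ d * #pos G w + u * #edges G + (s * (a * suc q) + d * k)
  bound G conn w lp with k ≤? #edges G
  ... | no k≰E = begin
    d * N                                              ≤⟨ *-monoʳ-≤ d N≤k ⟩
    d * k                                              ≤⟨ m≤n+m (d * k) (s * (a * suc q)) ⟩
    s * (a * suc q) + d * k                            ≤⟨ m≤n+m _ (d * P + u * #edges G) ⟩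
    d * P + u * #edges G + (s * (a * suc q) + d * k)   ∎
    where
    N = #neg G w
    P = #pos G w
    N≤k : N ≤ k
    N≤k = ≤-trans (m≤m+n N P) (≤-trans (≤-reflexive (≡-sym (#neg+#pos G w))) (<⇒≤ (≰⇒> k≰E)))
  ... | yes k≤E = begin
    d * N                                              ≡⟨ cong (_* N) d≡ ⟩
    (s * q + u) * N                                    ≡⟨ expand s q u N ⟩
    s * (q * N) + u * N                                ≤⟨ +-monoˡ-≤ (u * N) (*-monoʳ-≤ s (tour-bound X 1≤q)) ⟩
    s * (a * (suc (2 * P) + q)) + u * N                ≡⟨ collect s a P q u N ⟩
    s * (2 * a) * P + (u * N + s * (a * suc q))        ≡⟨ cong (λ x → x * P + (u * N + s * (a * suc q))) d+u≡ ⟨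
    (d + u) * P + (u * N + s * (a * suc q))            ≡⟨ regroup d u P N (s * (a * suc q)) ⟩
    d * P + u * (N + P) + s * (a * suc q)              ≡⟨ cong (λ e → d * P + u * e + s * (a * suc q)) (#neg+#pos G w) ⟨
    d * P + u * #edges G + s * (a * suc q)             ≤⟨ +-monoʳ-≤ (d * P + u * #edges G) (m≤m+n (s * (a * suc q)) (d * k)) ⟩
    d * P + u * #edges G + (s * (a * suc q) + d * k)   ∎
    where
    N = #neg G w
    P = #pos G w
    X : Contraction (n G) N P a q
    X = contraction G w conn lp k≤E k≤2a a+q≤k
    expand : ∀ s q u N → (s * q + u) * N ≡ s * (q * N) + u * N
    expand = solve-∀
    collect : ∀ s a P q u N → s * (a * (suc (2 * P) + q)) + u * N ≡ s * (2 * a) * P + (u * N + s * (a * suc q))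
    collect = solve-∀
    regroup : ∀ d u P N x → (d + u) * P + (u * N + x) ≡ d * P + u * (N + P) + x
    regroup = solve-∀


theorem1p1 : (𝒢 : Family) → (∀ G → IsTree G → 𝒢 G) → (∀ G → 𝒢 G → IsConnected G) →
    (Forcing 𝒢 1 × Forcing 𝒢 2 × Forcing 𝒢 4) ×
    (fEquals 𝒢 3 (+ 0) × fEquals 𝒢 5 -[1+ 0 ] × fEquals 𝒢 6 (+ 0) × fEquals 𝒢 8 -[1+ 0 ]) ×
    (∀ m → 1 ≤ m → Collapses 𝒢 (4 * m + 3) ×
    cEquals 𝒢 (4 * m + 3) (ℚ.- frac (+ m) (3 * m + 2))) ×
    (∀ m → 2 ≤ m → Collapses 𝒢 (4 * m + 2) ×
    cEquals 𝒢 (4 * m + 2) (ℚ.- frac (+ m ℤ.- + 1) (3 * m + 1))) ×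
    (∀ m → 2 ≤ m → Collapses 𝒢 (4 * m + 1) ×
    cAtMost 𝒢 (4 * m + 1) (ℚ.- frac (+ m ℤ.- + 1) (3 * m + 1)) ×
    cAtLeast 𝒢 (4 * m + 1) (ℚ.- frac (+ (2 * m) ℤ.- + 1) (6 * m + 1))) ×
    (∀ m → 3 ≤ m → Collapses 𝒢 (4 * m) ×
    cAtMost 𝒢 (4 * m) (ℚ.- frac (+ m ℤ.- + 2) (3 * m)) ×
    cAtLeast 𝒢 (4 * m) (ℚ.- frac (+ (2 * m) ℤ.- + 3) (6 * m ∸ 1)))
theorem1p1 𝒢 trees conn =
  (forcing-a≡0 conn 1 1 ≤-refl ≤-refl (n≤1+n 1) ≤-refl , forcing-a≡0 conn 2 2 (n≤1+n 1) ≤-refl ≤-refl (n≤1+n 1) , forcing-4 conn) ,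
  -- The spiders have p = a = 1, 2, 2, 3, and δ = 1 exactly when q = 2, 3, 4, 5 is odd.
  ( f-equals trees 3 0 0 z≤n ≤-refl ≤-refl (bound-3 conn)
  , f-equals trees 5 1 1 ≤-refl ≤-refl ≤-refl (bound-5 conn)
  , f-equals trees 6 1 0 z≤n (n≤1+n 5) ≤-refl (bound-6 conn)
  , f-equals trees 8 2 1 (n≤1+n 1) (n≤1+n 7) ≤-refl (bound-8 conn)
  ) ,
  k≡3 , k≡2 , k≡1 , k≡0
  where
  k≡3 : ∀ m → 1 ≤ m → Collapses 𝒢 (4 * m + 3) × cEquals 𝒢 (4 * m + 3) (ℚ.- frac (+ m) (3 * m + 2))
  -- Here a = 2m + 1 and q = 2m + 2 = 2p, so the tour and the spider give the same ratio.
  k≡3 m@(suc i) _ =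
    collapses trees m (2 * m + 1) (≤-trans (m≤m+n (2 + m) i) (≤-reflexive (e₀ i))) 2a<k k≤ ,
    tour-at-least conn 1 (2 * m + 1) (2 * m + 2) m (3 * m + 2) (3 * m + 1) (e₁ m) (e₂ m) (e₃ m)
      (≤-trans (n≤1+n 1) (m≤n+m 2 (2 * m))) (≤-trans (n≤1+n _) (≤-reflexive (e₄ m))) (≤-reflexive (e₅ m)) ,
    spider-at-most trees m (2 * m + 1) m (3 * m + 2) (e₆ m) (e₇ m) 2a<k k≤
    where
    2a<k : 2 * m + 1 + (2 * m + 1) < 4 * m + 3
    2a<k = ≤-reflexive (e m)
      where
      e : ∀ m → suc (2 * m + 1 + (2 * m + 1)) ≡ 4 * m + 3
      e = solve-∀
    k≤ : 4 * m + 3 ≤ 2 * m + 1 + (suc m + suc m)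
    k≤ = ≤-reflexive (e m)
      where
      e : ∀ m → 4 * m + 3 ≡ 2 * m + 1 + (suc m + suc m)
      e = solve-∀
    e₀ : ∀ i → 2 + suc i + i ≡ 2 * suc i + 1
    e₀ = solve-∀
    e₁ : ∀ m → 3 * m + 2 ≡ suc (3 * m + 1)
    e₁ = solve-∀
    e₂ : ∀ m → 3 * m + 2 ≡ 1 * (2 * m + 2) + m
    e₂ = solve-∀
    e₃ : ∀ m → 3 * m + 2 + m ≡ 1 * (2 * (2 * m + 1))
    e₃ = solve-∀
    e₄ : ∀ m → suc (4 * m + 3) ≡ suc (2 * m + 1) + suc (2 * m + 1)
    e₄ = solve-∀
    e₅ : ∀ m → 2 * m + 1 + (2 * m + 2) ≡ 4 * m + 3
    e₅ = solve-∀
    e₆ : ∀ m → 2 * m + 1 ≡ suc m + m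
    e₆ = solve-∀
    e₇ : ∀ m → 3 * m + 2 ≡ suc m + (2 * m + 1)
    e₇ = solve-∀
  k≡2 : ∀ m → 2 ≤ m → Collapses 𝒢 (4 * m + 2) × cEquals 𝒢 (4 * m + 2) (ℚ.- frac (+ m ℤ.- + 1) (3 * m + 1))
  k≡2 (suc zero) (s≤s ())
  k≡2 m@(suc i@(suc j)) _ =
    collapses trees m (2 * m) (≤-trans (m≤m+n (2 + m) j) (≤-reflexive (e₀ j))) 2a<k k≤ ,
    tour-at-least conn 1 (2 * m) (2 * m + 2) i (3 * m + 1) (3 * m) (e₁ m) (e₂ i) (e₃ i)
      (≤-trans (n≤1+n 1) (m≤n+m 2 (2 * m))) (≤-reflexive (e₄ m)) (≤-reflexive (e₅ m)) ,
    spider-at-most trees m (2 * m) i (3 * m + 1) (e₆ i) (e₇ m) 2a<k k≤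
    where
    2a<k : 2 * m + 2 * m < 4 * m + 2
    2a<k = ≤-trans (n≤1+n _) (≤-reflexive (e m))
      where
      e : ∀ m → suc (suc (2 * m + 2 * m)) ≡ 4 * m + 2
      e = solve-∀
    k≤ : 4 * m + 2 ≤ 2 * m + (suc m + suc m)
    k≤ = ≤-reflexive (e m)
      where
      e : ∀ m → 4 * m + 2 ≡ 2 * m + (suc m + suc m)
      e = solve-∀
    e₀ : ∀ j → 2 + (2 + j) + j ≡ 2 * (2 + j)
    e₀ = solve-∀
    e₁ : ∀ m → 3 * m + 1 ≡ suc (3 * m)
    e₁ = solve-∀
    e₂ : ∀ i → 3 * suc i + 1 ≡ 1 * (2 * suc i + 2) + i
    e₂ = solve-∀
    e₃ : ∀ i → 3 * suc i + 1 + i ≡ 1 * (2 * (2 * suc i))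
    e₃ = solve-∀
    e₄ : ∀ m → 4 * m + 2 ≡ suc (2 * m) + suc (2 * m)
    e₄ = solve-∀
    e₅ : ∀ m → 2 * m + (2 * m + 2) ≡ 4 * m + 2
    e₅ = solve-∀
    e₆ : ∀ i → 2 * suc i ≡ suc (suc i) + i
    e₆ = solve-∀
    e₇ : ∀ m → 3 * m + 1 ≡ suc m + 2 * m
    e₇ = solve-∀
  k≡1 : ∀ m → 2 ≤ m → Collapses 𝒢 (4 * m + 1) × cAtMost 𝒢 (4 * m + 1) (ℚ.- frac (+ m ℤ.- + 1) (3 * m + 1)) ×
    cAtLeast 𝒢 (4 * m + 1) (ℚ.- frac (+ (2 * m) ℤ.- + 1) (6 * m + 1))
  k≡1 (suc zero) (s≤s ())
  -- Here q = 2m + 1 is odd while p = m + 1, so the two ratios differ. The factor s = 2 clears the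
  -- half in (2a - q) / 2, and `i + (m + 0)` is the normal form of 2m - 1.
  k≡1 m@(suc i@(suc j)) _ =
    collapses trees m (2 * m) (≤-trans (m≤m+n (2 + m) j) (≤-reflexive (e₀ j))) 2a<k k≤ ,
    spider-at-most trees m (2 * m) i (3 * m + 1) (e₆ i) (e₇ m) 2a<k k≤ ,
    tour-at-least conn 2 (2 * m) (2 * m + 1) (i + (m + 0)) (6 * m + 1) (6 * m) (e₁ m) (e₂ i) (e₃ i)
      (m≤n+m 1 (2 * m)) (≤-trans (n≤1+n _) (≤-reflexive (e₄ m))) (≤-reflexive (e₅ m))
    where
    2a<k : 2 * m + 2 * m < 4 * m + 1
    2a<k = ≤-reflexive (e m)
      where
      e : ∀ m → suc (2 * m + 2 * m) ≡ 4 * m + 1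
      e = solve-∀
    k≤ : 4 * m + 1 ≤ 2 * m + (suc m + suc m)
    k≤ = ≤-trans (n≤1+n _) (≤-reflexive (e m))
      where
      e : ∀ m → suc (4 * m + 1) ≡ 2 * m + (suc m + suc m)
      e = solve-∀
    e₀ : ∀ j → 2 + (2 + j) + j ≡ 2 * (2 + j)
    e₀ = solve-∀
    e₁ : ∀ m → 6 * m + 1 ≡ suc (6 * m)
    e₁ = solve-∀
    e₂ : ∀ i → 6 * suc i + 1 ≡ 2 * (2 * suc i + 1) + (i + (suc i + 0))
    e₂ = solve-∀
    e₃ : ∀ i → 6 * suc i + 1 + (i + (suc i + 0)) ≡ 2 * (2 * (2 * suc i))
    e₃ = solve-∀
    e₄ : ∀ m → suc (4 * m + 1) ≡ suc (2 * m) + suc (2 * m)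
    e₄ = solve-∀
    e₅ : ∀ m → 2 * m + (2 * m + 1) ≡ 4 * m + 1
    e₅ = solve-∀
    e₆ : ∀ i → 2 * suc i ≡ suc (suc i) + i
    e₆ = solve-∀
    e₇ : ∀ m → 3 * m + 1 ≡ suc m + 2 * m
    e₇ = solve-∀
  k≡0 : ∀ m → 3 ≤ m → Collapses 𝒢 (4 * m) × cAtMost 𝒢 (4 * m) (ℚ.- frac (+ m ℤ.- + 2) (3 * m)) ×
    cAtLeast 𝒢 (4 * m) (ℚ.- frac (+ (2 * m) ℤ.- + 3) (6 * m ∸ 1))
  k≡0 (suc zero)       (s≤s ())
  k≡0 (suc (suc zero)) (s≤s (s≤s ()))
  -- In terms of i = m - 3: a = 2m - 1 = 5 + 2i and q = 2m + 1 = 7 + 2i. Identities involving 6m ∸ 1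
  -- are proved one higher and then lowered by `pred`.
  k≡0 m@(suc (suc (suc i))) _ =
    collapses trees m (5 + 2 * i) (≤-trans (m≤m+n (2 + m) i) (≤-reflexive (e₀ i))) 2a<k k≤ ,
    spider-at-most trees m (5 + 2 * i) (suc i) (3 * m) (e₆ i) (e₇ i) 2a<k k≤ ,
    tour-at-least conn 2 (5 + 2 * i) (7 + 2 * i) (i + (m + 0)) (6 * m ∸ 1) (16 + 6 * i) (cong pred (e₁ i))
      (cong pred (e₂ i)) (cong pred (e₃ i)) (s≤s z≤n) (≤-reflexive (e₄ i)) (≤-reflexive (e₅ i))
    where
    2a<k : 5 + 2 * i + (5 + 2 * i) < 4 * m
    2a<k = ≤-trans (n≤1+n _) (≤-reflexive (e i))
      where
      e : ∀ i → 2 + (5 + 2 * i + (5 + 2 * i)) ≡ 4 * (3 + i)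
      e = solve-∀
    k≤ : 4 * m ≤ 5 + 2 * i + (suc m + suc m)
    k≤ = ≤-trans (n≤1+n _) (≤-reflexive (e i))
      where
      e : ∀ i → suc (4 * (3 + i)) ≡ 5 + 2 * i + (4 + i + (4 + i))
      e = solve-∀
    e₀ : ∀ i → 2 + (3 + i) + i ≡ 5 + 2 * i
    e₀ = solve-∀
    e₁ : ∀ i → 6 * (3 + i) ≡ 2 + (16 + 6 * i)
    e₁ = solve-∀
    e₂ : ∀ i → 6 * (3 + i) ≡ suc (2 * (7 + 2 * i) + (i + (3 + i + 0)))
    e₂ = solve-∀
    e₃ : ∀ i → 6 * (3 + i) + (i + (3 + i + 0)) ≡ suc (2 * (2 * (5 + 2 * i)))
    e₃ = solve-∀
    e₄ : ∀ i → 4 * (3 + i) ≡ 6 + 2 * i + (6 + 2 * i)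
    e₄ = solve-∀
    e₅ : ∀ i → 5 + 2 * i + (7 + 2 * i) ≡ 4 * (3 + i)
    e₅ = solve-∀
    e₆ : ∀ i → 5 + 2 * i ≡ 4 + i + suc i
    e₆ = solve-∀
    e₇ : ∀ i → 3 * (3 + i) ≡ 4 + i + (5 + 2 * i)
    e₇ = solve-∀
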